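{- Let $G$ be a countably infinite discrete group and let $X$ be a Borel $G$-space. If $X$ admits a locally finitely traveling Borel complete section, then $X$ admits a Borel $32$-generator.
   Context: A Borel $G$-space is a standard Borel space $X$ equipped with a Borel action of $G$; $[x]_G$ denotes the orbit of $x$. A complete section is a subset of $X$ meeting every orbit. A $k$-generator for $X$ is a partition $\{A_n\}_{n<k}$ of $X$ into Borel sets (pieces may be empty) such that $\{gA_n : g\in G, n<k\}$ generates the Borel $\sigma$-algebra of $X$. Borel sets $A,B\subseteq X$ are locally finitely equidecomposable, written $A\sim_{\mathrm{lfin}}B$, if there are $N\le\infty$, elements $\{g_n\}_{n<N}\subseteq G$ and Borel partitions $\{A_n\}_{n<N}$ of $A$ and $\{B_n\}_{n<N}$ of $B$ such that $g_nA_n=B_n$ for all $n<N$ and, for every $x\in A$, $A_n\cap[x]_G=\emptyset$ for all but finitely many $n<N$. A Borel set $A\subseteq X$ is locally finitely traveling if there are pairwise disjoint Borel sets $\{A_n\}_{n\in\mathbb{N}}$ with $A_0=A$ and $A\sim_{\mathrm{lfin}}A_n$ for all $n\in\mathbb{N}$. -}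

module Defs where

open import Level using (Level; _⊔_; suc)
open import Algebra.Bundles using (Group)
open import Data.Fin.Base using (Fin)
open import Data.List.Base using (List)
import Data.List.Membership.Propositional as List
open import Data.Maybe.Base using (Maybe; just; nothing)
open import Data.Nat.Base as ℕ using (ℕ)
open import Data.Product.Base using (Σ-syntax; ∃-syntax; _×_; _,_)
open import Data.Rational.Base as ℚ using (ℚ; 0ℚ)
open import Function.Bundles using (Bijection)
open import Relation.Binary.Bundles using (Setoid)
open import Relation.Binary.Definitions using (_Respects_)
open import Relation.Binary.PropositionalEquality using (_≡_; _≢_)
import Relation.Binary.PropositionalEquality as ≡
open import Relation.Nullary using (¬_)
open import Relation.Unary
  using (Pred; _∈_; _≐_; _∩_; _⊥_; ∁; ⋃; Empty; _⟨×⟩_; _⊢_)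
open import Relation.Unary.Polymorphic using (∅)

-- Sets are setoids, so that quotients and function spaces are covered.
-- Subsets are predicates, identified up to _≐_.

CountablyInfinite : ∀ {a ℓ} → Setoid a ℓ → Set (a ⊔ ℓ)
CountablyInfinite S = Bijection (≡.setoid ℕ) S

-- The σ-algebra generated by 𝒢.  A σ-algebra of subsets contains a set
-- together with all its extensionally equal copies, hence `resp`.

data Generated {a ℓ m} {X : Set a} (𝒢 : Pred (Pred X ℓ) m) :
               Pred X ℓ → Set (a ⊔ suc ℓ ⊔ m) where
  gen   : ∀ {A} → 𝒢 A → Generated 𝒢 A
  empty : Generated 𝒢 ∅
  compl : ∀ {A} → Generated 𝒢 A → Generated 𝒢 (∁ A)
  union : ∀ {A : ℕ → Pred X ℓ} →
          (∀ n → Generated 𝒢 (A n)) → Generated 𝒢 (⋃ ℕ A)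
  resp  : ∀ {A B} → A ≐ B → Generated 𝒢 A → Generated 𝒢 B

-- A real-valued metric d, given through the relations d(x,y) < q with q
-- rational: {q | d(x,y) < q} is the upper Dedekind cut of d(x,y), and
-- `pos`, `finite` and `rounded` (with `triangle` and `reflexive`, which
-- make it upward closed) say that it is the cut of a real d(x,y) ≥ 0.

record Metric {ℓ} (S : Setoid ℓ ℓ) : Set (suc ℓ) where
  open Setoid S using (Carrier; _≈_)
  field
    d[_,_]<_  : Carrier → Carrier → ℚ → Set ℓ
    pos       : ∀ {x y q} → d[ x , y ]< q → 0ℚ ℚ.< q
    finite    : ∀ x y → ∃[ q ] d[ x , y ]< q
    rounded   : ∀ {x y q} → d[ x , y ]< q → ∃[ r ] (r ℚ.< q × d[ x , y ]< r)
    reflexive : ∀ {x y} → x ≈ y → ∀ q → 0ℚ ℚ.< q → d[ x , y ]< q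
    separated : ∀ {x y} → (∀ q → 0ℚ ℚ.< q → d[ x , y ]< q) → x ≈ y
    symmetric : ∀ {x y q} → d[ x , y ]< q → d[ y , x ]< q
    triangle  : ∀ {x y z q r} →
                d[ x , y ]< q → d[ y , z ]< r → d[ x , z ]< (q ℚ.+ r)

  Open : Pred (Pred Carrier ℓ) ℓ
  Open V = ∀ x → x ∈ V →
    ∃[ q ] (0ℚ ℚ.< q × (∀ y → d[ x , y ]< q → y ∈ V))

  Cauchy : Pred (ℕ → Carrier) ℓ
  Cauchy s = ∀ q → 0ℚ ℚ.< q →
    ∃[ N ] (∀ m n → N ℕ.≤ m → N ℕ.≤ n → d[ s m , s n ]< q)

  _ConvergesTo_ : (ℕ → Carrier) → Carrier → Set ℓ
  s ConvergesTo x = ∀ q → 0ℚ ℚ.< q →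
    ∃[ N ] (∀ n → N ℕ.≤ n → d[ s n , x ]< q)

  Complete : Set ℓ
  Complete = ∀ s → Cauchy s → ∃[ x ] (s ConvergesTo x)

  -- A countable dense set is enumerated by a sequence that may skip
  -- indices, so that the empty space is separable.
  Separable : Set ℓ
  Separable = Σ[ s ∈ (ℕ → Maybe Carrier) ]
    (∀ x q → 0ℚ ℚ.< q → ∃[ n ] ∃[ y ] (s n ≡ just y × d[ x , y ]< q))

-- A measurable space whose σ-algebra is that of the Borel sets of some
-- Polish topology; being equal to a generated σ-algebra, `Borel` needs no
-- separate closure axioms.

record StandardBorelSpace (ℓ : Level) : Set (suc (suc ℓ)) where
  field
    setoid : Setoid ℓ ℓ
  open Setoid setoid public
  field
    Borel    : Pred (Pred Carrier ℓ) (suc ℓ)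
    metric   : Metric setoid
    complete  : Metric.Complete metric
    separable : Metric.Separable metric
    borel-≐  : Borel ≐ Generated (Metric.Open metric)

-- For the discrete group G every subset of G is Borel, so the product Borel
-- structure on G × X is generated by the rectangles with arbitrary first
-- side.

module _ {ℓ} (G : Group ℓ ℓ) (X : StandardBorelSpace ℓ) where
  private
    module G = Group G
    module X = StandardBorelSpace X

  Rectangle : Pred (Pred (G.Carrier × X.Carrier) ℓ) (suc ℓ)
  Rectangle R = Σ[ S ∈ Pred G.Carrier ℓ ] Σ[ B ∈ Pred X.Carrier ℓ ]
    (S Respects G._≈_ × X.Borel B × R ≐ (S ⟨×⟩ B))

  ProductBorel : Pred (Pred (G.Carrier × X.Carrier) ℓ) (suc ℓ)
  ProductBorel = Generated Rectangle

record BorelGSpace {ℓ} (G : Group ℓ ℓ) : Set (suc (suc ℓ)) where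
  private module G = Group G
  field
    space : StandardBorelSpace ℓ
  open StandardBorelSpace space public
  infixr 8 _·_
  field
    _·_      : G.Carrier → Carrier → Carrier
    ·-cong   : ∀ {g h x y} → g G.≈ h → x ≈ y → g · x ≈ h · y
    ·-id     : ∀ x → G.ε · x ≈ x
    ·-assoc  : ∀ g h x → (g G.∙ h) · x ≈ g · h · x
    ·-borel  : ∀ A → Borel A → ProductBorel G space ((λ (g , x) → g · x) ⊢ A)

-- Numbers N ≤ ∞, with `nothing` for ∞, and the type of indices n < N.

ℕ∞ : Set
ℕ∞ = Maybe ℕ

Below : ℕ∞ → Set
Below (just n) = Fin n
Below nothing  = ℕ

module _ {ℓ} {G : Group ℓ ℓ} (X : BorelGSpace G) where
  private module G = Group G
  open BorelGSpace X

  Orbit : Carrier → Pred Carrier ℓ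
  Orbit x y = ∃[ g ] (g · x ≈ y)

  Translate : G.Carrier → Pred Carrier ℓ → Pred Carrier ℓ
  Translate g A y = ∃[ x ] (x ∈ A × g · x ≈ y)

  CompleteSection : Pred Carrier ℓ → Set ℓ
  CompleteSection A = ∀ x → ∃[ y ] (y ∈ A × y ∈ Orbit x)

  PairwiseDisjoint : {I : Set} → (I → Pred Carrier ℓ) → Set ℓ
  PairwiseDisjoint P = ∀ i j → i ≢ j → P i ⊥ P j

  -- Pieces may be empty.
  record BorelPartition (A : Pred Carrier ℓ) {I : Set}
                        (P : I → Pred Carrier ℓ) : Set (suc ℓ) where
    field
      borel    : ∀ i → Borel (P i)
      disjoint : PairwiseDisjoint P
      covers   : ⋃ I P ≐ A

  record _∼lfin_ (A B : Pred Carrier ℓ) : Set (suc ℓ) where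
    field
      N              : ℕ∞
      g              : Below N → G.Carrier
      P Q            : Below N → Pred Carrier ℓ
      P-partition    : BorelPartition A P
      Q-partition    : BorelPartition B Q
      translates     : ∀ n → Translate (g n) (P n) ≐ Q n
      locally-finite : ∀ x → x ∈ A → Σ[ L ∈ List (Below N) ]
        (∀ n → ¬ (n List.∈ L) → Empty (P n ∩ Orbit x))

  record LocallyFinitelyTraveling (A : Pred Carrier ℓ) : Set (suc ℓ) where
    field
      family     : ℕ → Pred Carrier ℓ
      borel      : ∀ n → Borel (family n)
      disjoint   : PairwiseDisjoint family
      family-0   : family 0 ≐ A
      equidecomp : ∀ n → A ∼lfin family n

  record Generator (k : ℕ) : Set (suc ℓ) where
    field
      piece     : Fin k → Pred Carrier ℓ
      borel     : ∀ n → Borel (piece n)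
      disjoint  : PairwiseDisjoint piece
      covers    : ∀ x → ∃[ n ] x ∈ piece n
      generates : Borel ≐
        Generated (λ C → ∃[ g ] ∃[ n ] C ≐ Translate g (piece n))

{-# OPTIONS --safe #-}

-- Enumerate G as e 0, e 1, ….  Greedy matching along this enumeration exhausts,
-- on every orbit, one of the two sets being matched, and it is definable from
-- translates of these two sets.  Pack copies of A greedily into X, one after
-- the other.  On an orbit where all copies fit, moving copy i to copy i + 1
-- injects the orbit into itself and misses a point.  Otherwise X is filled
-- while some point of the first n + 1 copies is left over.  Exchange these
-- copies for A_0, …, A_n, one piece of A ∼lfin A_j at a time (finitely many on
-- the orbit): in the end everything lies disjointly in X, so some exchange
-- turns a packing with leftovers into one without.  The inverse of the former,
-- the exchange and then the latter again inject the orbit into itself and miss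
-- a point.  This injection is definable from four sets: A, the part already
-- exchanged, the rest of the current copy, and the piece being exchanged.
--
-- Let ψ be the injection so obtained on all of X, and N the complement of its
-- range, a complete section.  The sets ψᵏ(N) are disjoint, so one further set
-- can record in ψᵏ(N) the k-th of countably many Borel subsets of N, and
-- thereby a countable basis.  Five sets cut X into 2⁵ pieces.

module Submission where

open import Defs
open import Level using (Level; Lift; lift; lower) renaming (suc to lsuc)
open import Algebra.Bundles using (Group)
open import Axiom.ExcludedMiddle using (ExcludedMiddle)
open import Data.Empty using (⊥; ⊥-elim)
open import Data.Fin.Base as Fin using (Fin; zero; suc; finToFun; funToFin)
import Data.Fin.Properties as Fin
open import Data.Integer.Base using (+_; -[1+_])
open import Data.List.Base using (List; []; _∷_)
open import Data.List.Membership.Propositional renaming (_∈_ to _∈ˡ_) using ()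
open import Data.List.Relation.Unary.Any using (here; there)
open import Data.Maybe.Base using (Maybe; just; nothing)
import Data.Maybe.Properties as Maybe
open import Data.Nat.Base as ℕ using (ℕ; zero; suc; _≤_; _<_; z≤n; s≤s)
import Data.Nat.Properties as ℕ
open import Data.Product.Base
  using (Σ-syntax; ∃-syntax; _×_; _,_; proj₁; proj₂; uncurry)
open import Data.Rational.Base as ℚ using (ℚ; mkℚ; 0ℚ; ½)
import Data.Rational.Properties as ℚ
open import Data.Sum.Base using (_⊎_; inj₁; inj₂; [_,_]′)
open import Function.Base using (_∘_; id)
open import Function.Bundles using (Bijection)
open import Relation.Binary.Definitions using (tri<; tri≈; tri>)
open import Relation.Binary.PropositionalEquality using (_≡_; _≢_)
import Relation.Binary.PropositionalEquality as ≡
open import Relation.Nullary using (¬_; Dec; yes; no; contradiction)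
open import Relation.Nullary.Decidable using (map′; decidable-stable; toSum)
open import Relation.Unary using (Pred; _∈_; _⊆_; _≐_; ∁; ⋃; _⊢_)
open import Relation.Unary.Polymorphic using (∅)

-- Enumerations of pairs and of positive rationals

step : ℕ × ℕ → ℕ × ℕ
step (zero  , b) = suc b , zero
step (suc a , b) = a , suc b

unpair : ℕ → ℕ × ℕ
unpair zero    = zero , zero
unpair (suc n) = step (unpair n)

-- The enumeration runs along antidiagonals: `(a , suc b)` comes right after `(suc a , b)`, and
-- `(suc s , 0)` right after `(0 , s)`.
unpair-surjective : ∀ p → ∃[ n ] unpair n ≡ p
unpair-surjective (a , b) = diagonal (a ℕ.+ b) a b ≡.refl
  where
  diagonal : ∀ s a b → a ℕ.+ b ≡ s → ∃[ n ] unpair n ≡ (a , b)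
  diagonal zero    zero zero _ = zero , ≡.refl
  diagonal (suc s) a    zero eq
    with n , eq′ ← diagonal s zero s ≡.refl
    rewrite ≡.trans (≡.sym (ℕ.+-identityʳ a)) eq = suc n , ≡.cong step eq′
  diagonal s a (suc b) eq
    with n , eq′ ← diagonal s (suc a) b (≡.trans (≡.sym (ℕ.+-suc a b)) eq)
    = suc n , ≡.cong step eq′

rational : ℕ × ℕ → ℚ
rational (a , b) = + a ℚ./ suc b

rational-surjective : ∀ q → 0ℚ ℚ.< q → ∃[ p ] rational p ≡ q
rational-surjective q@(mkℚ (+ a) b _) _ = (a , b) , ℚ.↥p/↧p≡p q
rational-surjective (mkℚ -[1+ _ ] _ _) (ℚ.*<* ())

halve : ∀ q → ½ ℚ.* q ℚ.+ ½ ℚ.* q ≡ q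
halve q = ≡.trans (≡.sym (ℚ.*-distribʳ-+ q ½ ½)) (ℚ.*-identityˡ q)

halve-positive : ∀ q → 0ℚ ℚ.< q → 0ℚ ℚ.< ½ ℚ.* q
halve-positive q q>0 =
  ≡.subst (ℚ._< ½ ℚ.* q) (ℚ.*-zeroʳ ½) (ℚ.*-monoʳ-<-pos ½ q>0)

difference : ∀ p q → p ℚ.+ (q ℚ.- p) ≡ q
difference p q = ≡.trans (≡.cong (p ℚ.+_) (ℚ.+-comm q (ℚ.- p)))
  (≡.trans (≡.sym (ℚ.+-assoc p (ℚ.- p) q))
    (≡.trans (≡.cong (ℚ._+ q) (ℚ.+-inverseʳ p)) (ℚ.+-identityˡ q)))

difference-positive : ∀ p q → p ℚ.< q → 0ℚ ℚ.< q ℚ.- p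
difference-positive p q p<q =
  ≡.subst (ℚ._< q ℚ.- p) (ℚ.+-inverseʳ p) (ℚ.+-monoˡ-< (ℚ.- p) p<q)

module Classical {ℓ} (em : ExcludedMiddle (lsuc ℓ)) where

  decide : (P : Set ℓ) → Dec P
  decide P = map′ lower lift (em {Lift (lsuc ℓ) P})

  decide₀ : (P : Set) → Dec P
  decide₀ P = map′ lower lift (em {Lift (lsuc ℓ) P})

  byContradiction : {P : Set ℓ} → ¬ ¬ P → P
  byContradiction = decidable-stable (decide _)

-- Group actions and σ-algebras

module Actions {ℓ} (em : ExcludedMiddle (lsuc ℓ)) (G : Group ℓ ℓ)
  (enumeration : CountablyInfinite (Group.setoid G)) (X : BorelGSpace G) where

  open Classical em
  private module G = Group G
  open G using (ε; _∙_) renaming (_⁻¹ to infix 9 _⁻¹)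
  open BorelGSpace X

  Subset : Set (lsuc ℓ)
  Subset = Pred Carrier ℓ

  e : ℕ → G.Carrier
  e = Bijection.to enumeration

  code : G.Carrier → ℕ
  code g = proj₁ (Bijection.surjective enumeration g)

  e-code : ∀ g → e (code g) G.≈ g
  e-code g = proj₂ (Bijection.surjective enumeration g) ≡.refl

  infixr 8 _⁻¹·_
  _⁻¹·_ : ℕ → Carrier → Carrier
  n ⁻¹· x = e n ⁻¹ · x

  ·-congˡ : ∀ g {x y} → x ≈ y → g · x ≈ g · y
  ·-congˡ g = ·-cong G.refl

  code-· : ∀ g x → e (code g) · x ≈ g · x
  code-· g x = ·-cong (e-code g) refl

  ⁻¹·-· : ∀ g x → g ⁻¹ · g · x ≈ x
  ⁻¹·-· g x = trans (sym (·-assoc _ _ _))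
    (trans (·-cong (G.inverseˡ g) refl) (·-id x))

  ·-⁻¹· : ∀ g x → g · g ⁻¹ · x ≈ x
  ·-⁻¹· g x = trans (sym (·-assoc _ _ _))
    (trans (·-cong (G.inverseʳ g) refl) (·-id x))

  ·-cancel : ∀ g {x y} → g · x ≈ g · y → x ≈ y
  ·-cancel g eq = trans (sym (⁻¹·-· g _)) (trans (·-congˡ _ eq) (⁻¹·-· g _))

  ·-move : ∀ g {x y} → g · x ≈ y → x ≈ g ⁻¹ · y
  ·-move g eq = trans (sym (⁻¹·-· g _)) (·-congˡ _ eq)

  -- Measurability in a σ-algebra, agreement of two sets on an orbit, and
  -- invariance under _≈_ are all preserved by the same operations, so that
  -- each construction below needs a single closure proof.  A set is measurable,
  -- or invariant under _≈_, if it is related to itself.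

  record σ-Relation : Set (lsuc (lsuc ℓ)) where
    infix 4 _~_
    field
      _~_    : Subset → Subset → Set (lsuc ℓ)
      resp~  : ∀ {A A′ B B′} → A ≐ A′ → B ≐ B′ → A ~ B → A′ ~ B′
      empty~ : ∅ ~ ∅
      ¬~     : ∀ {A B} → A ~ B → ∁ A ~ ∁ B
      ∃~     : ∀ {A B : ℕ → Subset} → (∀ n → A n ~ B n) →
               (λ x → ∃[ n ] A n x) ~ (λ x → ∃[ n ] B n x)
      shift~ : ∀ g {A B} → A ~ B → (g ·_) ⊢ A ~ (g ·_) ⊢ B

    ∀~ : ∀ {A B : ℕ → Subset} → (∀ n → A n ~ B n) →
         (λ x → ∀ n → A n x) ~ (λ x → ∀ n → B n x)
    ∀~ r = resp~ dual dual (¬~ (∃~ λ n → ¬~ (r n)))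
      where
      dual : {A : ℕ → Subset} →
             (λ x → ¬ (∃[ n ] ¬ A n x)) ≐ (λ x → ∀ n → A n x)
      dual = (λ ne n → byContradiction λ na → ne (n , na)) ,
             (λ { all (n , na) → na (all n) })

    infixr 2 _×~_
    infixr 1 _⊎~_
    _⊎~_ : ∀ {A A′ B B′ : Subset} → A ~ A′ → B ~ B′ →
           (λ x → A x ⊎ B x) ~ (λ x → A′ x ⊎ B′ x)
    _⊎~_ {A} {A′} {B} {B′} r s =
      resp~ (eq A B) (eq A′ B′) (∃~ λ { zero → r ; (suc _) → s })
      where
      pick : Subset → Subset → ℕ → Subset
      pick A B zero    = A
      pick A B (suc _) = B
      eq : ∀ A B → (λ x → ∃[ n ] pick A B n x) ≐ (λ x → A x ⊎ B x)
      eq A B = (λ { (zero , a) → inj₁ a ; (suc _ , b) → inj₂ b }) ,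
           [ (λ a → 0 , a) , (λ b → 1 , b) ]′

    _×~_ : ∀ {A A′ B B′ : Subset} → A ~ A′ → B ~ B′ →
           (λ x → A x × B x) ~ (λ x → A′ x × B′ x)
    _×~_ {A} {A′} {B} {B′} r s =
      resp~ (eq A B) (eq A′ B′) (¬~ (¬~ r ⊎~ ¬~ s))
      where
      eq : ∀ (A B : Subset) → (λ x → ¬ (¬ A x ⊎ ¬ B x)) ≐ (λ x → A x × B x)
      eq A B = (λ f → byContradiction (f ∘ inj₁) , byContradiction (f ∘ inj₂)) ,
           (λ { (a , b) → [ (λ na → na a) , (λ nb → nb b) ]′ })

    const~ : ∀ P → (λ _ → P) ~ (λ _ → P)
    const~ P with decide P
    ... | yes p = resp~ eq eq (¬~ empty~)
      where
      eq : ∁ ∅ ≐ (λ _ → P)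
      eq = (λ _ → p) , (λ _ → lower)
    ... | no np = resp~ eq eq empty~
      where
      eq : ∅ ≐ (λ _ → P)
      eq = (λ ()) , (λ p → ⊥-elim (np p))

    infixr 2 _⟨×⟩~_
    _⟨×⟩~_ : ∀ (P : Set) {A B : Subset} → A ~ B →
             (λ x → P × A x) ~ (λ x → P × B x)
    _⟨×⟩~_ P {A} {B} r = resp~ (eq A) (eq B) (const~ (Lift ℓ P) ×~ r)
      where
      eq : ∀ (A : Subset) → (λ x → Lift ℓ P × A x) ≐ (λ x → P × A x)
      eq A = (λ { (lift p , a) → p , a }) , (λ { (p , a) → lift p , a })

  infix 4 _~⟨_⟩_
  _~⟨_⟩_ : Subset → σ-Relation → Subset → Set (lsuc ℓ)
  A ~⟨ R ⟩ B = σ-Relation._~_ R A B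

  -- Preimages under `g` commute with complements and countable unions, so closure under shifts need
  -- only be known for the generators.
  generatedBy : (𝒢 : Pred Subset ℓ) →
    (∀ g {A} → A ∈ 𝒢 → Generated 𝒢 ((g ·_) ⊢ A)) → σ-Relation
  generatedBy 𝒢 closed = record
    { _~_    = λ A B → Generated 𝒢 A × Generated 𝒢 B
    ; resp~  = λ { eq eq′ (a , b) → resp eq a , resp eq′ b }
    ; empty~ = empty , empty
    ; ¬~     = λ { (a , b) → compl a , compl b }
    ; ∃~     = λ r → union (proj₁ ∘ r) , union (proj₂ ∘ r)
    ; shift~ = λ { g (a , b) → shift g a , shift g b }
    }
    where
    shift : ∀ g {A} → Generated 𝒢 A → Generated 𝒢 ((g ·_) ⊢ A)
    shift g (gen a)            = closed g a
    shift g empty              = empty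
    shift g (compl a)          = compl (shift g a)
    shift g (union a)          = union (shift g ∘ a)
    shift g (resp (f , f′) a) = resp ((λ {x} → f) , (λ {x} → f′)) (shift g a)

  -- The section at `g` of a rectangle with sides `S` and `B` is `B` or empty according to whether
  -- `g` lies in `S`. Measurability of the action on the product thus makes the preimage of a Borel
  -- set under each single `g` Borel.
  borel-section : ∀ g {R} → ProductBorel G space R → Borel (λ x → R (g , x))
  borel-section g = proj₂ borel-≐ ∘ cut
    where
    open Metric metric using (Open)
    cut : ∀ {R} → ProductBorel G space R → Generated Open (λ x → R (g , x))
    cut (gen (S , B , _ , bB , eq₁ , eq₂)) with decide (S g)
    ... | yes s = resp ((λ b → eq₂ (s , b)) , (λ r → proj₂ (eq₁ r)))
                    (proj₁ borel-≐ bB)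
    ... | no ns = resp ((λ ()) , (λ r → ⊥-elim (ns (proj₁ (eq₁ r))))) empty
    cut empty                = empty
    cut (compl r)            = compl (cut r)
    cut (union r)            = union (cut ∘ r)
    cut (resp (f , f′) r)    = resp (f , f′) (cut r)

  borelSets : σ-Relation
  borelSets = record
    { _~_    = λ A B → Borel A × Borel B
    ; resp~  = λ { eq eq′ (a , b) → borel-resp eq a , borel-resp eq′ b }
    ; empty~ = proj₂ borel-≐ empty , proj₂ borel-≐ empty
    ; ¬~     = λ { (a , b) → borel-∁ a , borel-∁ b }
    ; ∃~     = λ r → borel-⋃ (proj₁ ∘ r) , borel-⋃ (proj₂ ∘ r)
    ; shift~ = λ { g (a , b) → borel-section g (·-borel _ a) ,
                               borel-section g (·-borel _ b) }
    }
    where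
    borel-resp : ∀ {A B} → A ≐ B → Borel A → Borel B
    borel-resp eq = proj₂ borel-≐ ∘ resp eq ∘ proj₁ borel-≐
    borel-∁ : ∀ {A} → Borel A → Borel (∁ A)
    borel-∁ = proj₂ borel-≐ ∘ compl ∘ proj₁ borel-≐
    borel-⋃ : ∀ {A : ℕ → Subset} → (∀ n → Borel (A n)) → Borel (⋃ ℕ A)
    borel-⋃ a = proj₂ borel-≐ (union (proj₁ borel-≐ ∘ a))

  BorelSet : Subset → Set (lsuc ℓ)
  BorelSet A = A ~⟨ borelSets ⟩ A

  agreement : (ρ : Carrier → Carrier → Set ℓ) →
    (∀ g {x y} → ρ x y → ρ (g · x) (g · y)) → σ-Relation
  agreement ρ invariant = record
    { _~_    = λ A B → Lift (lsuc ℓ)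
                 (∀ {x y} → ρ x y → (A x → B y) × (B y → A x))
    ; resp~  = λ { (f , f′) (h , h′) (lift r) → lift λ xy →
                 (h ∘ proj₁ (r xy) ∘ f′) , (f ∘ proj₂ (r xy) ∘ h′) }
    ; empty~ = lift λ _ → (λ ()) , (λ ())
    ; ¬~     = λ { (lift r) → lift λ xy →
                 (λ na b → na (proj₂ (r xy) b)) ,
                 (λ nb a → nb (proj₁ (r xy) a)) }
    ; ∃~     = λ r → lift λ xy →
                 (λ { (n , a) → n , proj₁ (lower (r n) xy) a }) ,
                 (λ { (n , b) → n , proj₂ (lower (r n) xy) b })
    ; shift~ = λ { g (lift r) → lift λ xy → r (invariant g xy) }
    }

  equality : σ-Relation
  equality = agreement _≈_ ·-congˡ

  Invariant : Subset → Set (lsuc ℓ)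
  Invariant A = A ~⟨ equality ⟩ A

  transport : ∀ {A x y} → Invariant A → x ≈ y → A x → A y
  transport (lift r) xy = proj₁ (r xy)

  Orbit-· : ∀ {x y} g → Orbit X x y → Orbit X x (g · y)
  Orbit-· g (h , hx≈y) = g ∙ h , trans (·-assoc g h _) (·-congˡ g hx≈y)

  Orbit-≈ : ∀ {x y z} → y ≈ z → Orbit X x y → Orbit X x z
  Orbit-≈ y≈z (h , hx≈y) = h , trans hx≈y y≈z

  Orbit-refl : ∀ x → Orbit X x x
  Orbit-refl x = ε , ·-id x

  orbit-code : ∀ {x y z} → Orbit X x y → Orbit X x z → ∃[ n ] e n · y ≈ z
  orbit-code {x} {y} {z} (g , gx≈y) (h , hx≈z) = code (h ∙ g ⁻¹) ,
    trans (code-· _ _) (trans (·-assoc _ _ _)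
      (trans (·-congˡ h (sym (·-move g gx≈y))) hx≈z))

  -- Agreement on an orbit is preserved by everything built from shifts and Boolean operations; this
  -- is what allows a construction to change from orbit to orbit.
  onOrbit : Carrier → σ-Relation
  onOrbit x = agreement (λ y z → Orbit X x y × y ≈ z)
    (λ { g (o , yz) → Orbit-· g o , ·-congˡ g yz })

  invariant⇒onOrbit : ∀ {A} x → Invariant A → A ~⟨ onOrbit x ⟩ A
  invariant⇒onOrbit x (lift r) = lift λ { (_ , yz) → r yz }

  Range : (ℕ → Subset) → Subset
  Range R y = ∃[ n ] R n (n ⁻¹· y)

  range-intro : ∀ {R : ℕ → Subset} {n x y} →
    Invariant (R n) → R n x → e n · x ≈ y → R n (n ⁻¹· y)
  range-intro inv r eq = transport inv (·-move _ eq) r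

  antitone : (A : ℕ → Subset) → (∀ n {x} → A (suc n) x → A n x) →
    ∀ {m n x} → m ≤ n → A n x → A m x
  antitone A down = go ∘ ℕ.≤⇒≤′
    where
    go : ∀ {m n x} → m ℕ.≤′ n → A n x → A m x
    go (ℕ.≤′-reflexive ≡.refl) a = a
    go (ℕ.≤′-step m≤n)         a = go m≤n (down _ a)

  -- Greedy matching and packing

  -- All of stage `n` can happen at once: acting by `e n` is injective, so no two sources compete
  -- for one target.
  mutual

    free : Subset → Subset → ℕ → Subset
    free D E zero      = D
    free D E (suc n) x = free D E n x × ¬ greedy D E n x

    vacant : Subset → Subset → ℕ → Subset
    vacant D E zero      = E
    vacant D E (suc n) y = vacant D E n y × ¬ greedy D E n (n ⁻¹· y)

    greedy : Subset → Subset → ℕ → Subset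
    greedy D E n x = free D E n x × vacant D E n (e n · x)

  module _ (R : σ-Relation) where

    open σ-Relation R

    mutual

      free~ : ∀ {D D′ E E′} → D ~ D′ → E ~ E′ → ∀ n → free D E n ~ free D′ E′ n
      free~ d v zero    = d
      free~ d v (suc n) = free~ d v n ×~ ¬~ (greedy~ d v n)

      vacant~ : ∀ {D D′ E E′} → D ~ D′ → E ~ E′ →
                ∀ n → vacant D E n ~ vacant D′ E′ n
      vacant~ d v zero    = v
      vacant~ d v (suc n) =
        vacant~ d v n ×~ ¬~ (shift~ (e n ⁻¹) (greedy~ d v n))

      greedy~ : ∀ {D D′ E E′} → D ~ D′ → E ~ E′ →
                ∀ n → greedy D E n ~ greedy D′ E′ n
      greedy~ d v n = free~ d v n ×~ shift~ (e n) (vacant~ d v n)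

  module _ (D E : Subset) where

    greedy-source : ∀ n {x} → greedy D E n x → D x
    greedy-source n = antitone (free D E) (λ _ → proj₁) z≤n ∘ proj₁

    greedy-target : ∀ n {x} → greedy D E n x → E (e n · x)
    greedy-target n = antitone (vacant D E) (λ _ → proj₁) z≤n ∘ proj₂

    greedy-functional : ∀ m n {x} → greedy D E m x → greedy D E n x → m ≡ n
    greedy-functional m n r s with ℕ.<-cmp m n
    ... | tri< m<n _ _ = contradiction r
      (proj₂ (antitone (free D E) (λ _ → proj₁) m<n (proj₁ s)))
    ... | tri≈ _ eq _  = eq
    ... | tri> _ _ n<m = contradiction s
      (proj₂ (antitone (free D E) (λ _ → proj₁) n<m (proj₁ r)))

    module _ (invD : Invariant D) (invE : Invariant E) where

      greedy-injective : ∀ m n {x y} → greedy D E m x → greedy D E n y →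
        e m · x ≈ e n · y → m ≡ n
      greedy-injective m n r s eq with ℕ.<-cmp m n
      ... | tri< m<n _ _ = contradiction
        (range-intro {greedy D E} (greedy~ equality invD invE m) r eq)
        (proj₂ (antitone (vacant D E) (λ _ → proj₁) m<n (proj₂ s)))
      ... | tri≈ _ m≡n _ = m≡n
      ... | tri> _ _ n<m = contradiction
        (range-intro {greedy D E} (greedy~ equality invD invE n) s (sym eq))
        (proj₂ (antitone (vacant D E) (λ _ → proj₁) n<m (proj₂ r)))

      -- Some `e n` carries `x` to `y`. Were `y` missed, both points would still be available at
      -- stage `n` and would be matched there.
      greedy-exhausts : ∀ {z x y} → Orbit X z x → Orbit X z y →
        D x → ¬ (∃[ n ] greedy D E n x) → E y → Range (greedy D E) y
      greedy-exhausts {z} {x} {y} ox oy d unmatched v =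
        byContradiction λ missed →
          let n , eq = orbit-code ox oy in
          unmatched (n , stays-free n , transport
            (vacant~ equality invD invE n) (sym eq) (stays-vacant missed n))
        where
        stays-free : ∀ n → free D E n x
        stays-free zero    = d
        stays-free (suc n) = stays-free n , λ r → unmatched (n , r)
        stays-vacant : ¬ Range (greedy D E) y → ∀ n → vacant D E n y
        stays-vacant missed zero    = v
        stays-vacant missed (suc n) =
          stays-vacant missed n , λ r → missed (n , r)

  -- The copies are a family `H` instead of one repeated set because the first of them will later be
  -- exchanged piece by piece.
  mutual

    unfilled : Subset → (ℕ → Subset) → ℕ → Subset
    unfilled E H zero      = E
    unfilled E H (suc i) y = unfilled E H i y × ¬ Range (packing E H i) y

    packing : Subset → (ℕ → Subset) → ℕ → ℕ → Subset
    packing E H i = greedy (H i) (unfilled E H i)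

  module _ (R : σ-Relation) where

    open σ-Relation R

    Range~ : ∀ {R R′ : ℕ → Subset} → (∀ n → R n ~ R′ n) → Range R ~ Range R′
    Range~ r = ∃~ λ n → shift~ (e n ⁻¹) (r n)

    unfilled~ : ∀ {E E′} {H H′ : ℕ → Subset} → E ~ E′ → (∀ i → H i ~ H′ i) →
      ∀ i → unfilled E H i ~ unfilled E′ H′ i
    unfilled~ v h zero    = v
    unfilled~ v h (suc i) = unfilled~ v h i ×~
      ¬~ (Range~ (greedy~ R (h i) (unfilled~ v h i)))

    packing~ : ∀ {E E′} {H H′ : ℕ → Subset} → E ~ E′ → (∀ i → H i ~ H′ i) →
      ∀ i n → packing E H i n ~ packing E′ H′ i n
    packing~ v h i = greedy~ R (h i) (unfilled~ v h i)

  module Packing (E : Subset) (H : ℕ → Subset) where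

    packing-source : ∀ i n {x} → packing E H i n x → H i x
    packing-source i = greedy-source (H i) (unfilled E H i)

    packing-target : ∀ i n {x} → packing E H i n x → E (e n · x)
    packing-target i n = antitone (unfilled E H) (λ _ → proj₁) z≤n ∘
      greedy-target (H i) (unfilled E H i) n

    packing-functional : ∀ i m n {x} →
      packing E H i m x → packing E H i n x → m ≡ n
    packing-functional i = greedy-functional (H i) (unfilled E H i)

    module _ (invE : Invariant E) (invH : ∀ i → Invariant (H i)) where

      private
        inv-packing : ∀ i n → Invariant (packing E H i n)
        inv-packing = packing~ equality invE invH

        inv-unfilled : ∀ i → Invariant (unfilled E H i)
        inv-unfilled = unfilled~ equality invE invH

        avoids : ∀ i j m n {x y} → i < j → packing E H i m x →
          packing E H j n y → ¬ (e m · x ≈ e n · y)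
        avoids i j m n i<j r s eq = proj₂
          (antitone (unfilled E H) (λ _ → proj₁) i<j
            (greedy-target (H j) (unfilled E H j) n s))
          (m , range-intro {packing E H i} (inv-packing i m) r eq)

      packing-injective : ∀ i j m n {x y} → packing E H i m x →
        packing E H j n y → e m · x ≈ e n · y → i ≡ j × m ≡ n
      packing-injective i j m n r s eq with ℕ.<-cmp i j
      ... | tri< i<j _ _ = ⊥-elim (avoids i j m n i<j r s eq)
      ... | tri≈ _ ≡.refl _ =
        ≡.refl , greedy-injective (H i) (unfilled E H i)
          (invH i) (inv-unfilled i) m n r s eq
      ... | tri> _ _ j<i = ⊥-elim (avoids j i n m j<i s r (sym eq))

      -- Either an earlier copy has taken `y`, or `y` is still available to copy `i`; as this copy
      -- leaves `x` over, it takes all that is available on the orbit.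
      packing-exhausts : ∀ {z x y i} → Orbit X z x → Orbit X z y →
        H i x → ¬ (∃[ n ] packing E H i n x) → E y →
        ∃[ j ] (j ≤ i × Range (packing E H j) y)
      packing-exhausts {z} {x} {y} {i} ox oy h unmatched v
        with remains i
        where
        remains : ∀ i → unfilled E H i y ⊎
                        ∃[ j ] (j ≤ i × Range (packing E H j) y)
        remains zero = inj₁ v
        remains (suc i) with remains i
        ... | inj₂ (j , j≤i , r) = inj₂ (j , ℕ.m≤n⇒m≤1+n j≤i , r)
        ... | inj₁ u with decide (Range (packing E H i) y)
        ... | yes r  = inj₂ (i , ℕ.n≤1+n i , r)
        ... | no ¬r = inj₁ (u , ¬r)
      ... | inj₂ found = found
      ... | inj₁ u = i , ℕ.≤-refl ,
        greedy-exhausts (H i) (unfilled E H i) (invH i) (inv-unfilled i)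
          ox oy h unmatched u

  -- The bound `r` counts down: it drops by one whenever a copy has been exchanged completely, which
  -- makes the exchange argument terminate.
  data Stuck (E : Subset) (H : ℕ → Subset) (r : ℕ) (z : Carrier) : Set ℓ where
    stuck-at : ∀ i {x} → i ≤ r → Orbit X z x → H i x →
      ¬ (∃[ n ] packing E H i n x) → Stuck E H r z

  unstuck : ∀ {E H r z} → ¬ Stuck E H r z → ∀ {i x} → i ≤ r →
    Orbit X z x → H i x → ∃[ n ] packing E H i n x
  unstuck ¬stuck i≤r o h =
    byContradiction λ ¬p → ¬stuck (stuck-at _ i≤r o h ¬p)

  module _ (z : Carrier) where

    open σ-Relation (onOrbit z)

    stuck-cong : ∀ {E E′} {H H′ : ℕ → Subset} {r} → E ~ E′ →
      (∀ i → H i ~ H′ i) → Stuck E H r z → Stuck E′ H′ r z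
    stuck-cong v h (stuck-at i i≤r o hx unmatched) =
      stuck-at i i≤r o (proj₁ (lower (h i) (o , refl)) hx) λ { (n , p) →
        unmatched
          (n , proj₂ (lower (packing~ (onOrbit z) v h i n) (o , refl)) p) }

    -- A copy without points on the orbit takes no room there, so deleting it leaves the packing of
    -- the later copies unchanged. The leftover point cannot belong to it, hence `r` is a successor.
    stuck-shift : ∀ {E} {H : ℕ → Subset} {r} → Invariant E →
      (∀ i → Invariant (H i)) → (∀ {x} → Orbit X z x → ¬ H 0 x) →
      Stuck E H r z → ∃[ s ] (r ≡ suc s × Stuck E (H ∘ suc) s z)
    stuck-shift _ _ noH (stuck-at zero _ o h _) = ⊥-elim (noH o h)
    stuck-shift {E} {H} invE invH noH
      (stuck-at (suc i) (s≤s i≤s) o h unmatched) =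
      _ , ≡.refl , stuck-at i i≤s o h λ { (n , p) → unmatched (n , proj₂ (lower
        (greedy~ (onOrbit z) (invariant⇒onOrbit z (invH (suc i))) (same i) n)
        (o , refl)) p) }
      where
      same : ∀ i → unfilled E H (suc i) ~ unfilled E (H ∘ suc) i
      same zero = lift λ { (o , yy′) →
        (λ { (v , _) → transport invE yy′ v }) ,
        (λ v → transport invE (sym yy′) v ,
          λ { (n , p) → noH (Orbit-· _ o) (Packing.packing-source E H 0 n p) }) }
      same (suc i) = same i ×~ ¬~ (Range~ (onOrbit z)
        (greedy~ (onOrbit z) (invariant⇒onOrbit z (invH (suc i))) (same i)))

  -- Self-injections of orbits

  -- A sequence S of sets stands for the relation "x is sent to e n · x" for
  -- x ∈ S n.  The condition says that on the orbit of x it is total, that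
  -- the image point determines the group element (hence the source), and
  -- that some point is missed.

  Compressed : (ℕ → Subset) → Subset
  Compressed S x =
    (∀ h → ∃[ m ] S m (e h · x)) ×
    (∀ h m n → ¬ (m ≢ n × S m (e h · x) × S n (n ⁻¹· e m · e h · x))) ×
    ∃[ h ] ¬ Range S (e h · x)

  module _ (R : σ-Relation) where

    open σ-Relation R

    Compressed~ : ∀ {S S′ : ℕ → Subset} → (∀ n → S n ~ S′ n) →
      Compressed S ~ Compressed S′
    Compressed~ s =
      (∀~ λ h → ∃~ λ m → shift~ (e h) (s m)) ×~
      (∀~ λ h → ∀~ λ m → ∀~ λ n → ¬~ ((m ≢ n) ⟨×⟩~ shift~ (e h) (s m) ×~
        shift~ (e h) (shift~ (e m) (shift~ (e n ⁻¹) (s n))))) ×~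
      (∃~ λ h → shift~ (e h) (¬~ (Range~ R s)))

  orbit-step : ∀ {x y} → Orbit X x y → ∀ h → ∃[ k ] e k · x ≈ e h · y
  orbit-step o h = orbit-code (Orbit-refl _) (Orbit-· _ o)

  Orbit-sym : ∀ {x y} → Orbit X x y → Orbit X y x
  Orbit-sym (g , eq) = g ⁻¹ , sym (·-move g eq)

  -- `Compressed` uses its point only to enumerate the orbit, so moving the point merely renumbers
  -- the quantifiers. Hence what works at one point works on the whole orbit.
  compressed-orbit : ∀ {S : ℕ → Subset} → (∀ n → Invariant (S n)) →
    ∀ {x y} → Orbit X x y → Compressed S x → Compressed S y
  compressed-orbit {S} inv {x} {y} o (total , injective , h₀ , missed) =
    total′ , injective′ ,
    let k , eq = orbit-step (Orbit-sym o) h₀ in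
    k , λ r → missed (transport (Range~ equality inv) eq r)
    where
    total′ : ∀ h → ∃[ m ] S m (e h · y)
    total′ h with k , eq ← orbit-step o h with m , s ← total k =
      m , transport (inv m) eq s
    injective′ : ∀ h m n →
      ¬ (m ≢ n × S m (e h · y) × S n (n ⁻¹· e m · e h · y))
    injective′ h m n (m≢n , s , s′) with k , eq ← orbit-step o h =
      injective k m n (m≢n , transport (inv m) (sym eq) s ,
        transport (inv n) (·-congˡ _ (·-congˡ _ (sym eq))) s′)

  -- If the sets source t and target t both move the points with tag t, then
  -- the image under the former is sent to the image under the latter.

  transfer : (source target : ℕ → ℕ → Subset) → ℕ → Subset
  transfer source target m y = ∃[ t ] ∃[ n ] ∃[ k ]
    (m ≡ code (e k ∙ e n ⁻¹) × source t n (n ⁻¹· y) × target t k (n ⁻¹· y))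

  module _ (R : σ-Relation) where

    open σ-Relation R

    transfer~ : ∀ {s s′ t t′ : ℕ → ℕ → Subset} →
      (∀ i n → s i n ~ s′ i n) → (∀ i n → t i n ~ t′ i n) →
      ∀ m → transfer s t m ~ transfer s′ t′ m
    transfer~ s t m = ∃~ λ i → ∃~ λ n → ∃~ λ k → (m ≡ code (e k ∙ e n ⁻¹)) ⟨×⟩~
      shift~ (e n ⁻¹) (s i n) ×~ shift~ (e n ⁻¹) (t i k)

  -- Injectivity of `target` recovers the tag and the common starting point from the final image,
  -- and `source` being functional then recovers the rest of the group element. A point with an
  -- arrow in `target` but none in `source` under the same tag supplies the missed image.
  transfer-compressed : ∀ (source target : ℕ → ℕ → Subset) z →
    (∀ t n → Invariant (source t n)) →
    (∀ t m n {x} → source t m x → source t n x → m ≡ n) →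
    (∀ t u m n {x y} → target t m x → target u n y → e m · x ≈ e n · y →
      t ≡ u × m ≡ n) →
    (∀ {y} → Orbit X z y → ∃[ t ] ∃[ n ] ∃[ k ]
      (source t n (n ⁻¹· y) × target t k (n ⁻¹· y))) →
    ∃[ t ] ∃[ k ] ∃[ x ]
      (Orbit X z x × target t k x × ¬ (∃[ n ] source t n x)) →
    Compressed (transfer source target) z
  transfer-compressed source target z inv functional injective covers
    (t₀ , k₀ , x₀ , o₀ , tgt₀ , escapes) = total , injective′ , missed
    where
    S = transfer source target

    arrives : ∀ {m n k y} → m ≡ code (e k ∙ e n ⁻¹) →
      e k · n ⁻¹· y ≈ e m · y
    arrives ≡.refl = trans (sym (·-assoc _ _ _)) (sym (code-· _ _))

    total : ∀ h → ∃[ m ] S m (e h · z)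
    total h with t , n , k , s , r ← covers (Orbit-· (e h) (Orbit-refl z)) =
      _ , t , n , k , ≡.refl , s , r

    injective′ : ∀ h m n →
      ¬ (m ≢ n × S m (e h · z) × S n (n ⁻¹· e m · e h · z))
    injective′ h m m′
      (m≢m′ , (t , n , k , eq , s , r) , (t′ , n′ , k′ , eq′ , s′ , r′))
      with arrive ← trans (arrives eq) (trans (sym (·-⁻¹· _ _)) (sym (arrives eq′)))
      with injective t t′ k k′ r r′ arrive
    ... | ≡.refl , ≡.refl
      with functional t n n′ s
             (transport (inv t n′) (sym (·-cancel (e k) arrive)) s′)
    ... | ≡.refl = m≢m′ (≡.trans eq (≡.sym eq′))

    missed : ∃[ h ] ¬ Range S (e h · z)
    missed with h , eq ← orbit-code (Orbit-refl z) (Orbit-· (e k₀) o₀) =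
      h , λ { (m , t , n , k , eq′ , s , r) → hit eq′ s r
        (trans (arrives eq′) (trans (·-⁻¹· _ _) eq)) }
      where
      hit : ∀ {m t n k y} → m ≡ code (e k ∙ e n ⁻¹) → source t n (n ⁻¹· y) →
        target t k (n ⁻¹· y) → ¬ (e k · n ⁻¹· y ≈ e k₀ · x₀)
      hit {t = t} {n} {k} _ s r eq with injective t t₀ k k₀ r tgt₀ eq
      ... | ≡.refl , ≡.refl = escapes (n , transport (inv t n) (·-cancel _ eq) s)

  -- Two strategies for compressing an orbit

  infixr 5 _◂_
  _◂_ : Subset → (ℕ → Subset) → ℕ → Subset
  (T ◂ H) zero    = T
  (T ◂ H) (suc i) = H i

  -- base is A, joined the part of the family A_j already exchanged (it stays
  -- in place), rest the part of the current copy of A not yet exchanged, and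
  -- moving ⊆ rest the piece exchanged next.

  Labels : Set (lsuc ℓ)
  Labels = Fin 4 → Subset

  pattern base   = zero
  pattern joined = suc zero
  pattern rest   = suc (suc zero)
  pattern moving = suc (suc (suc zero))

  -- nothing if all copies of A fit into X; just g if moving is exchanged for
  -- its translate by g.

  Strategy : Set ℓ
  Strategy = Maybe G.Carrier

  module _ (I : Labels) where

    copies : ℕ → ℕ → Subset
    copies = packing (∁ ∅) (λ _ → I base)

    before : ℕ → ℕ → Subset
    before = packing (∁ (I joined)) (I rest ◂ λ _ → I base)

    joined′ : G.Carrier → Subset
    joined′ g y = I joined y ⊎ I moving (g ⁻¹ · y)

    rest′ : Subset
    rest′ x = I rest x × ¬ I moving x

    after : G.Carrier → ℕ → ℕ → Subset
    after g = packing (∁ (joined′ g)) (rest′ ◂ λ _ → I base)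

    -- Tag 0 holds the points left in place.  For nothing, tag 1 has no source,
    -- so that copy i goes to copy i + 1 and copy 0 is missed.

    source : Strategy → ℕ → ℕ → Subset
    source nothing  zero          n x =
      n ≡ code ε × (∀ i → ¬ Range (copies i) x)
    source nothing  (suc zero)    n   = ∅
    source nothing  (suc (suc i)) n   = copies i n
    source (just g) zero          n x = n ≡ code ε × I joined x
    source (just g) (suc i)       n   = before i n

    target : Strategy → ℕ → ℕ → Subset
    target nothing  zero          n   = source nothing zero n
    target nothing  (suc i)       n   = copies i n
    target (just g) zero          n   = source (just g) zero n
    target (just g) (suc zero)    n x = n ≡ code g × I moving x ⊎ after g 0 n x
    target (just g) (suc (suc i)) n   = after g (suc i) n

    shrink : Strategy → ℕ → Subset
    shrink s = transfer (source s) (target s)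

  module Strategy~ (R : σ-Relation) {I I′ : Labels}
    (r : ∀ i → I i ~⟨ R ⟩ I′ i) where

    open σ-Relation R

    copies~ : ∀ i n → copies I i n ~ copies I′ i n
    copies~ = packing~ R (¬~ empty~) (λ _ → r base)

    ◂~ : ∀ {T T′} → T ~ T′ →
      ∀ i → (T ◂ λ _ → I base) i ~ (T′ ◂ λ _ → I′ base) i
    ◂~ t zero    = t
    ◂~ t (suc i) = r base

    joined′~ : ∀ g → joined′ I g ~ joined′ I′ g
    joined′~ g = r joined ⊎~ shift~ (g ⁻¹) (r moving)

    rest′~ : rest′ I ~ rest′ I′
    rest′~ = r rest ×~ ¬~ (r moving)

    after~ : ∀ g i n → after I g i n ~ after I′ g i n
    after~ g = packing~ R (¬~ (joined′~ g)) (◂~ rest′~)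

    source~ : ∀ s t n → source I s t n ~ source I′ s t n
    source~ nothing  zero          n =
      (n ≡ code ε) ⟨×⟩~ ∀~ λ i → ¬~ (Range~ R (copies~ i))
    source~ nothing  (suc zero)    n = empty~
    source~ nothing  (suc (suc i)) n = copies~ i n
    source~ (just g) zero          n = (n ≡ code ε) ⟨×⟩~ r joined
    source~ (just g) (suc i)       n =
      packing~ R (¬~ (r joined)) (◂~ (r rest)) i n

    target~ : ∀ s t n → target I s t n ~ target I′ s t n
    target~ nothing  zero          n = source~ nothing zero n
    target~ nothing  (suc i)       n = copies~ i n
    target~ (just g) zero          n = source~ (just g) zero n
    target~ (just g) (suc zero)    n =
      (n ≡ code g) ⟨×⟩~ r moving ⊎~ after~ g 0 n
    target~ (just g) (suc (suc i)) n = after~ g (suc i) n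

    shrink~ : ∀ s m → shrink I s m ~ shrink I′ s m
    shrink~ s = transfer~ R (source~ s) (target~ s)

  module _ {I : Labels} (inv : ∀ i → Invariant (I i)) (z : Carrier) where

    private module E~ = Strategy~ equality inv

    code-ε : ∀ {n x} → n ≡ code ε → e n · x ≈ x
    code-ε ≡.refl = trans (code-· ε _) (·-id _)

    code-ε⁻¹ : ∀ x → x ≈ code ε ⁻¹· x
    code-ε⁻¹ x = ·-move _ (code-ε {x = x} ≡.refl)

    copies-compressed : (∃[ x ] (Orbit X z x × I base x)) →
      (∀ r → ¬ Stuck (∁ ∅) (λ _ → I base) r z) →
      Compressed (shrink I nothing) z
    copies-compressed (x₀ , o₀ , b₀) ¬stuck =
      transfer-compressed (source I nothing) (target I nothing) z
        (E~.source~ nothing) functional injective covers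
        -- Under tag 1 `target` places copy 0 while `source` is empty, so the place of `x₀` in copy
        -- 0 is missed.
        (1 , _ , x₀ , o₀ , proj₂ (copy 0 o₀ b₀) , λ ())
      where
      open Packing (∁ ∅) (λ _ → I base)
      inv∁∅ : Invariant (∁ ∅)
      inv∁∅ = σ-Relation.¬~ equality (σ-Relation.empty~ equality)

      copy : ∀ i {x} → Orbit X z x → I base x → ∃[ n ] copies I i n x
      copy i = unstuck (¬stuck i) ℕ.≤-refl

      functional : ∀ t m n {x} →
        source I nothing t m x → source I nothing t n x → m ≡ n
      functional zero          m n (p , _) (q , _) = ≡.trans p (≡.sym q)
      functional (suc (suc i)) m n p q = packing-functional i m n p q

      away : ∀ {i m n x y} → source I nothing zero m x → copies I i n y →
        ¬ (e m · x ≈ e n · y)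
      away {i} {n = n} (p , out) c eq = out i (n ,
        range-intro {copies I i} (E~.copies~ i n) c (trans (sym eq) (code-ε p)))

      injective : ∀ t u m n {x y} → target I nothing t m x →
        target I nothing u n y → e m · x ≈ e n · y → t ≡ u × m ≡ n
      injective zero zero m n (p , _) (q , _) _ =
        ≡.refl , ≡.trans p (≡.sym q)
      injective zero (suc j) m n p q eq = ⊥-elim (away {j} p q eq)
      injective (suc i) zero m n p q eq = ⊥-elim (away {i} q p (sym eq))
      injective (suc i) (suc j) m n p q eq
        with i≡j , m≡n ← packing-injective inv∁∅ (λ _ → inv base) i j m n p q eq =
        ≡.cong suc i≡j , m≡n

      covers : ∀ {y} → Orbit X z y → ∃[ t ] ∃[ n ] ∃[ k ]
        (source I nothing t n (n ⁻¹· y) × target I nothing t k (n ⁻¹· y))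
      covers {y} o with decide (∃[ i ] Range (copies I i) y)
      ... | yes (i , n , c)
        with k , c′ ← copy (suc i) (Orbit-· (e n ⁻¹) o) (packing-source i n c) =
        suc (suc i) , n , k , c , c′
      ... | no ¬c = 0 , code ε , code ε , out , out
        where
        out : source I nothing 0 (code ε) (code ε ⁻¹· y)
        out = ≡.refl , λ i r → ¬c (i , transport
          (Range~ equality (E~.copies~ i)) (sym (code-ε⁻¹ y)) r)

    -- The leftover point forces the packing before the exchange to fill the orbit outside `joined`,
    -- and afterwards every point involved still finds a place. The new place of the leftover point
    -- is the image of nothing.
    exchange-compressed : ∀ g r →
      (∀ {x} → I moving x → I rest x) →
      (∀ {x} → I moving x → ¬ I joined (g · x)) →
      Stuck (∁ (I joined)) (I rest ◂ λ _ → I base) r z →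
      ¬ Stuck (∁ (joined′ I g)) (rest′ I ◂ λ _ → I base) r z →
      Compressed (shrink I (just g)) z
    exchange-compressed g r moving⊆rest moves-out
      (stuck-at i₀ {x₀} i₀≤r o₀ h₀ unmatched) ¬stuck =
      transfer-compressed (source I (just g)) (target I (just g)) z
        (E~.source~ (just g)) functional injective covers
        (suc i₀ , proj₁ (sends i₀ i₀≤r o₀ h₀) , x₀ , o₀ ,
          proj₂ (sends i₀ i₀≤r o₀ h₀) , unmatched)
      where
      open σ-Relation equality using (¬~)
      module B = Packing (∁ (I joined)) (I rest ◂ λ _ → I base)
      module A = Packing (∁ (joined′ I g)) (rest′ I ◂ λ _ → I base)

      -- In the first copy the exchanged piece travels by `g`; all other points have a place in the
      -- packing after the exchange, which leaves nothing over up to index `r`.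
      sends : ∀ i → i ≤ r → ∀ {x} → Orbit X z x → (I rest ◂ λ _ → I base) i x →
        ∃[ n ] target I (just g) (suc i) n x
      sends zero i≤r {x} o h with decide (I moving x)
      ... | yes p = code g , inj₁ (≡.refl , p)
      ... | no ¬p with n , a ← unstuck ¬stuck i≤r o (h , ¬p) = n , inj₂ a
      sends (suc i) i≤r o h = unstuck ¬stuck i≤r o h

      functional : ∀ t m n {x} →
        source I (just g) t m x → source I (just g) t n x → m ≡ n
      functional zero    m n (p , _) (q , _) = ≡.trans p (≡.sym q)
      functional (suc i) m n p q = B.packing-functional i m n p q

      -- Three kinds of arrows: they end in `joined`, in the translate of `moving` (disjoint from
      -- `joined` by `moves-out`), or outside both. Arrows of different kinds therefore never meet.
      classify : ∀ t n {x} → target I (just g) t n x →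
        (t ≡ 0 × n ≡ code ε × I joined x) ⊎
        (t ≡ 1 × n ≡ code g × I moving x) ⊎
        ∃[ i ] (t ≡ suc i × after I g i n x)
      classify zero          n (p , q)        = inj₁ (≡.refl , p , q)
      classify (suc zero)    n (inj₁ (p , q)) = inj₂ (inj₁ (≡.refl , p , q))
      classify (suc zero)    n (inj₂ p)       = inj₂ (inj₂ (0 , ≡.refl , p))
      classify (suc (suc i)) n p              = inj₂ (inj₂ (suc i , ≡.refl , p))

      stays : ∀ {n x y} → n ≡ code ε → I joined x → e n · x ≈ y → I joined y
      stays p j eq = transport (inv joined) (trans (sym (code-ε p)) eq) j

      moved : ∀ {n x y} → n ≡ code g → I moving x → e n · x ≈ y →
        I moving (g ⁻¹ · y)
      moved ≡.refl p eq =
        transport (inv moving) (·-move g (trans (sym (code-· g _)) eq)) p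

      disjoint : ∀ {m n x y} → m ≡ code ε → I joined x → n ≡ code g →
        I moving y → ¬ (e m · x ≈ e n · y)
      disjoint p j ≡.refl q eq =
        moves-out q (stays p j (trans eq (code-· g _)))

      injective : ∀ t u m n {x y} → target I (just g) t m x →
        target I (just g) u n y → e m · x ≈ e n · y → t ≡ u × m ≡ n
      injective t u m n p q eq with classify t m p | classify u n q
      ... | inj₁ (≡.refl , ≡.refl , _) | inj₁ (≡.refl , ≡.refl , _) =
        ≡.refl , ≡.refl
      ... | inj₁ (_ , p′ , j) | inj₂ (inj₁ (_ , q′ , k)) =
        ⊥-elim (disjoint p′ j q′ k eq)
      ... | inj₁ (_ , p′ , j) | inj₂ (inj₂ (i , _ , a)) =
        ⊥-elim (A.packing-target i n a (inj₁ (stays p′ j eq)))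
      ... | inj₂ (inj₁ (_ , p′ , j)) | inj₁ (_ , q′ , k) =
        ⊥-elim (disjoint q′ k p′ j (sym eq))
      ... | inj₂ (inj₁ (≡.refl , ≡.refl , _))
          | inj₂ (inj₁ (≡.refl , ≡.refl , _)) = ≡.refl , ≡.refl
      ... | inj₂ (inj₁ (_ , p′ , j)) | inj₂ (inj₂ (i , _ , a)) =
        ⊥-elim (A.packing-target i n a (inj₂ (moved p′ j eq)))
      ... | inj₂ (inj₂ (i , _ , a)) | inj₁ (_ , q′ , k) =
        ⊥-elim (A.packing-target i m a (inj₁ (stays q′ k (sym eq))))
      ... | inj₂ (inj₂ (i , _ , a)) | inj₂ (inj₁ (_ , q′ , k)) =
        ⊥-elim (A.packing-target i m a (inj₂ (moved q′ k (sym eq))))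
      ... | inj₂ (inj₂ (i , ≡.refl , a)) | inj₂ (inj₂ (j , ≡.refl , b))
        with ≡.refl , m≡n ← A.packing-injective (¬~ (E~.joined′~ g))
               (E~.◂~ E~.rest′~) i j m n a b eq = ≡.refl , m≡n

      covers : ∀ {y} → Orbit X z y → ∃[ t ] ∃[ n ] ∃[ k ]
        (source I (just g) t n (n ⁻¹· y) × target I (just g) t k (n ⁻¹· y))
      covers {y} o with decide (I joined y)
      ... | yes j = 0 , code ε , code ε , fixed , fixed
        where
        fixed : source I (just g) 0 (code ε) (code ε ⁻¹· y)
        fixed = ≡.refl , transport (inv joined) (code-ε⁻¹ y) j
      ... | no ¬j
        with i , i≤i₀ , n , b ← B.packing-exhausts (¬~ (inv joined))
               (E~.◂~ (inv rest)) o₀ o h₀ unmatched ¬j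
        with k , a ← sends i (ℕ.≤-trans i≤i₀ i₀≤r) (Orbit-· (e n ⁻¹) o)
               (B.packing-source i n b) = suc i , n , k , b , a

  -- The exchange argument

  first : (ℕ → Subset) → ℕ → Subset
  first V n x = V n x × ¬ (∃[ m ] (m < n × V m x))

  first~ : ∀ (R : σ-Relation) {V V′ : ℕ → Subset} →
    (∀ n → V n ~⟨ R ⟩ V′ n) → ∀ n → first V n ~⟨ R ⟩ first V′ n
  first~ R v n = v n ×~ ¬~ (∃~ λ m → (m < n) ⟨×⟩~ v m)
    where open σ-Relation R

  first-exists : ∀ (V : ℕ → Subset) {x} → ∃[ n ] V n x → ∃[ n ] first V n x
  first-exists V {x} (n , v) =
    [ id , (λ none → ⊥-elim (none n ℕ.≤-refl v)) ]′ (search (suc n))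
    where
    search : ∀ n → ∃[ m ] first V m x ⊎ (∀ m → m < n → ¬ V m x)
    search zero = inj₂ λ _ ()
    search (suc n) with search n | decide (V n x)
    ... | inj₁ found | _     = inj₁ found
    ... | inj₂ none  | yes v = inj₁ (n , v , λ { (m , m<n , w) → none m m<n w })
    ... | inj₂ none  | no ¬v = inj₂ λ m m<1+n w →
      [ (λ m<n → none m m<n w) , (λ { ≡.refl → ¬v w }) ]′
        (ℕ.m<1+n⇒m<n∨m≡n m<1+n)

  first-unique : ∀ (V : ℕ → Subset) {m n x} →
    first V m x → first V n x → m ≡ n
  first-unique V {m} {n} (v , none) (v′ , none′) with ℕ.<-cmp m n
  ... | tri< m<n _ _ = ⊥-elim (none′ (m , m<n , v))
  ... | tri≈ _ eq _  = eq
  ... | tri> _ _ n<m = ⊥-elim (none (n , n<m , v′))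

  patch : (V F : ℕ → Subset) → Subset
  patch V F x = ∃[ n ] (first V n x × F n x)

  patch~ : ∀ (R : σ-Relation) {V V′ F F′ : ℕ → Subset} →
    (∀ n → V n ~⟨ R ⟩ V′ n) → (∀ n → F n ~⟨ R ⟩ F′ n) →
    patch V F ~⟨ R ⟩ patch V′ F′
  patch~ R v f = ∃~ λ n → first~ R v n ×~ f n
    where open σ-Relation R

  -- The conditions `V m` are constant on orbits, so the first one to hold is the same along the
  -- orbit of `z`, and `patch` follows a single `F n` there.
  patch-onOrbit : ∀ (V F : ℕ → Subset) {n z} →
    (∀ m {x y} → Orbit X x y → V m x → V m y) → (∀ m → Invariant (F m)) →
    first V n z → patch V F ~⟨ onOrbit z ⟩ F n
  patch-onOrbit V F {n} {z} spread inv (v , none) = lift λ { {x} {y} (o , eq) →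
    (λ { (m , fm , f) → transport (inv n) eq
      (≡.subst (λ k → F k x) (first-unique V fm (nearby o)) f) }) ,
    (λ f → n , nearby o , transport (inv n) (sym eq) f) }
    where
    nearby : ∀ {x} → Orbit X z x → first V n x
    nearby o = spread n o v ,
      λ { (m , m<n , w) → none (m , m<n , spread m (Orbit-sym o) w) }

  -- Points equal under `≈` lie at distance less than every positive rational, so open sets cannot
  -- separate them; neither can the sets they generate.
  borel-invariant : ∀ {A} → Borel A → Invariant A
  borel-invariant = generated ∘ proj₁ borel-≐
    where
    open Metric metric using (Open)
    open σ-Relation equality
    open-invariant : ∀ {V x y} → Open V → x ≈ y → V x → V y
    open-invariant isOpen eq v with q , q>0 , ball ← isOpen _ v =
      ball _ (Metric.reflexive metric eq q q>0)
    generated : ∀ {A} → Generated Open A → Invariant A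
    generated (gen o) = lift λ eq →
      open-invariant o eq , open-invariant o (sym eq)
    generated empty      = empty~
    generated (compl a)  = ¬~ (generated a)
    generated (union a)  = ∃~ (generated ∘ a)
    generated (resp (f , f′) a) = resp~ (f , f′) (f , f′) (generated a)

  -- Locally finite equidecompositions indexed by `ℕ`

  number : ∀ N → Below N → ℕ
  number (just _) = Fin.toℕ
  number nothing  = id

  number-injective : ∀ N {i j} → number N i ≡ number N j → i ≡ j
  number-injective (just _) = Fin.toℕ-injective
  number-injective nothing  = id

  bound : ∀ {N} (L : List (Below N)) →
    ∃[ K ] (∀ b → b ∈ˡ L → number N b < K)
  bound [] = 0 , λ _ ()
  bound {N} (b ∷ L) with K , below ← bound L =
    suc (number N b) ℕ.⊔ K , λ
      { _ (here ≡.refl) → ℕ.m≤m⊔n (suc (number N b)) K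
      ; c (there c∈L)   →
          ℕ.≤-trans (below c c∈L) (ℕ.m≤n⊔m (suc (number N b)) K) }

  module Equidecomposition {A B : Subset} (eq : _∼lfin_ X A B) where

    open _∼lfin_ eq
    private
      module P = BorelPartition P-partition
      module Q = BorelPartition Q-partition

    piece : ℕ → Subset
    piece l x = ∃[ b ] (number N b ≡ l × P b x)

    mover : ℕ → G.Carrier
    mover l with decide₀ (∃[ b ] number N b ≡ l)
    ... | yes (b , _) = g b
    -- An index that numbers no piece has an empty `piece`, so the default `ε` moves nothing.
    ... | no _        = ε

    mover-number : ∀ b → mover (number N b) ≡ g b
    mover-number b with decide₀ (∃[ c ] number N c ≡ number N b)
    ... | yes (c , c≡b) = ≡.cong g (number-injective N c≡b)
    ... | no none       = ⊥-elim (none (b , ≡.refl))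

    piece-borel : ∀ l → BorelSet (piece l)
    piece-borel l with decide₀ (∃[ b ] number N b ≡ l)
    ... | yes (b , ≡.refl) =
      σ-Relation.resp~ borelSets eq′ eq′ (P.borel b , P.borel b)
      where
      eq′ : P b ≐ piece (number N b)
      eq′ = (λ p → b , ≡.refl , p) , λ { (c , c≡b , p) →
        ≡.subst (λ c → P c _) (number-injective N c≡b) p }
    ... | no none = σ-Relation.resp~ borelSets eq′ eq′
      (σ-Relation.empty~ borelSets)
      where
      eq′ : ∅ ≐ piece l
      eq′ = (λ ()) , λ { (b , b≡l , _) → ⊥-elim (none (b , b≡l)) }

    piece⊆ : ∀ {l x} → piece l x → A x
    piece⊆ (b , _ , p) = proj₁ P.covers (b , p)

    piece-cover : ∀ {x} → A x → ∃[ l ] piece l x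
    piece-cover a with b , p ← proj₂ P.covers a = _ , b , ≡.refl , p

    piece-disjoint : ∀ {l m x} → piece l x → piece m x → l ≡ m
    piece-disjoint (b , ≡.refl , p) (c , ≡.refl , q) with decide₀ (b ≡ c)
    ... | yes ≡.refl = ≡.refl
    ... | no b≢c     = ⊥-elim (P.disjoint b c b≢c (p , q))

    private
      image : ∀ {l x} → piece l x → ∃[ b ] (number N b ≡ l × Q b (mover l · x))
      image {x = x} (b , ≡.refl , p) = b , ≡.refl ,
        ≡.subst (λ h → Q b (h · x)) (≡.sym (mover-number b))
          (proj₁ (translates b) (x , p , refl))

    piece-image : ∀ {l x} → piece l x → B (mover l · x)
    piece-image p with b , _ , q ← image p = proj₁ Q.covers (b , q)

    image-disjoint : ∀ {l m x y} → piece l x → piece m y →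
      mover l · x ≈ mover m · y → l ≡ m
    image-disjoint p p′ eq with image p | image p′
    ... | b , ≡.refl , q | c , ≡.refl , q′ with decide₀ (b ≡ c)
    ... | yes ≡.refl = ≡.refl
    ... | no b≢c = ⊥-elim (Q.disjoint b c b≢c
      (transport (borel-invariant (Q.borel b)) eq q , q′))

    image-cover : ∀ {y} → B y → ∃[ l ] piece l (mover l ⁻¹ · y)
    image-cover {y} b with c , q ← proj₂ Q.covers b
      with x , p , eq ← proj₂ (translates c) q =
      number N c , c , ≡.refl , transport (borel-invariant (P.borel c))
        (·-move _ (≡.subst (λ h → h · x ≈ y) (≡.sym (mover-number c)) eq)) p

    -- Local finiteness is stated at points of `A`, so it is applied at `y` and carried over to `z`
    -- along their common orbit.
    piece-bound : ∀ z → (∃[ y ] (A y × Orbit X z y)) →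
      ∃[ K ] (∀ l {x} → K ≤ l → Orbit X z x → ¬ piece l x)
    piece-bound z (y , a , o)
      with L , finite ← locally-finite y a
      with K , below ← bound L =
      K , λ { _ K≤l o′ (b , ≡.refl , p) →
        finite b (λ b∈L → ℕ.<-irrefl ≡.refl (ℕ.≤-trans (below b b∈L) K≤l)) _
          (p , orbit-trans (Orbit-sym o) o′) }
      where
      orbit-trans : ∀ {u v w} → Orbit X u v → Orbit X v w → Orbit X u w
      orbit-trans uv (h , eq) = Orbit-≈ eq (Orbit-· h uv)

  -- Exchanging copies for the traveling family

  module Traveling {A : Subset} (borelA : Borel A)
    (complete : CompleteSection X A) (traveling : LocallyFinitelyTraveling X A)
    where

    open LocallyFinitelyTraveling traveling
      renaming (borel to family-borel; disjoint to family-disjoint)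
    module _ (j : ℕ) where
      open Equidecomposition (equidecomp j) public

    invA : Invariant A
    invA = borel-invariant borelA

    -- The labels after the first j copies of A, and the first k pieces of the
    -- next one, have been exchanged for the corresponding parts of the family.

    config : ℕ → ℕ → Labels
    config j k base     = A
    config j k joined y = (∃[ i ] (i < j × family i y)) ⊎
      (∃[ l ] (l < k × piece j l (mover j l ⁻¹ · y)))
    config j k rest x   = A x × ¬ (∃[ l ] (l < k × piece j l x))
    config j k moving   = piece j k

    config-borel : ∀ j k i → BorelSet (config j k i)
    config-borel j k base   = borelA , borelA
    config-borel j k joined =
      (∃~ λ i → (i < j) ⟨×⟩~ (family-borel i , family-borel i)) ⊎~
      (∃~ λ l → (l < k) ⟨×⟩~ shift~ (mover j l ⁻¹) (piece-borel j l))
      where open σ-Relation borelSets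
    config-borel j k rest   = (borelA , borelA) ×~
      ¬~ (∃~ λ l → (l < k) ⟨×⟩~ piece-borel j l)
      where open σ-Relation borelSets
    config-borel j k moving = piece-borel j k

    config-invariant : ∀ j k i → Invariant (config j k i)
    config-invariant j k i = borel-invariant (proj₁ (config-borel j k i))

    moving⊆rest : ∀ j k {x} → piece j k x → config j k rest x
    moving⊆rest j k p = piece⊆ j p , λ { (l , l<k , q) →
      ℕ.<-irrefl (piece-disjoint j q p) l<k }

    -- Members of the family are disjoint, and so are the images of different pieces; hence a piece
    -- arrives outside all that was exchanged before.
    moves-out : ∀ j k {x} → piece j k x → ¬ config j k joined (mover j k · x)
    moves-out j k p (inj₁ (i , i<j , q)) =
      family-disjoint i j (ℕ.<⇒≢ i<j) (q , piece-image j p)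
    moves-out j k p (inj₂ (l , l<k , q)) =
      ℕ.<-irrefl (image-disjoint j q p (·-⁻¹· _ _)) l<k

    joined-step : ∀ j k →
      joined′ (config j k) (mover j k) ≐ config j (suc k) joined
    joined-step j k =
      (λ { (inj₁ (inj₁ f))             → inj₁ f
         ; (inj₁ (inj₂ (l , l<k , p))) → inj₂ (l , ℕ.m<n⇒m<1+n l<k , p)
         ; (inj₂ p)                    → inj₂ (k , ℕ.≤-refl , p) }) ,
      (λ { (inj₁ f) → inj₁ (inj₁ f)
         ; (inj₂ (l , l<1+k , p)) →
           [ (λ l<k → inj₁ (inj₂ (l , l<k , p))) ,
             (λ { ≡.refl → inj₂ p }) ]′ (ℕ.m<1+n⇒m<n∨m≡n l<1+k) })

    rest-step : ∀ j k → rest′ (config j k) ≐ config j (suc k) rest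
    rest-step j k =
      (λ { ((a , none) , ¬p) → a , λ { (l , l<1+k , p) →
           [ (λ l<k → none (l , l<k , p)) , (λ { ≡.refl → ¬p p }) ]′
             (ℕ.m<1+n⇒m<n∨m≡n l<1+k) } }) ,
      (λ { (a , none) →
           (a , (λ { (l , l<k , p) → none (l , ℕ.m<n⇒m<1+n l<k , p) })) ,
           (λ p → none (k , ℕ.≤-refl , p)) })

    module _ (z : Carrier) where

      open σ-Relation (onOrbit z)

      agree : ∀ {B C} → Invariant C → (∀ {y} → Orbit X z y → B y → C y) →
        (∀ {y} → Orbit X z y → C y → B y) → B ~ C
      agree inv to from = lift λ { (o , eq) →
        transport inv eq ∘ to o , from o ∘ transport inv (sym eq) }

      StuckAt : ℕ → ℕ → ℕ → Set ℓ
      StuckAt j k r = Stuck (∁ (config j k joined))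
        (config j k rest ◂ λ _ → A) r z

      Exchanges : ℕ → ℕ → ℕ → Set ℓ
      Exchanges j k r = StuckAt j k r ×
        ¬ Stuck (∁ (joined′ (config j k) (mover j k)))
          (rest′ (config j k) ◂ λ _ → A) r z

      stuck-step : ∀ {j k r} → ¬ Exchanges j k r →
        StuckAt j k r → StuckAt j (suc k) r
      stuck-step {j} {k} none stuck =
        stuck-cong z (¬~ (agree (config-invariant j (suc k) joined)
            (λ _ → proj₁ (joined-step j k)) (λ _ → proj₂ (joined-step j k))))
          (λ { zero → agree (config-invariant j (suc k) rest)
                 (λ _ → proj₁ (rest-step j k)) (λ _ → proj₂ (rest-step j k))
             ; (suc i) → invariant⇒onOrbit z invA })
          (byContradiction λ ¬stuck → none (stuck , ¬stuck))

      stuck-reach : ∀ {j r} → (∀ k → ¬ Exchanges j k r) → StuckAt j 0 r →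
        ∀ k → StuckAt j k r
      stuck-reach none stuck zero    = stuck
      stuck-reach none stuck (suc k) =
        stuck-step (none k) (stuck-reach none stuck k)

      module _ {j : ℕ} where

        grow : ∀ K {y} → config j K joined y → config (suc j) 0 joined y
        grow K (inj₁ (i , i<j , f))  = inj₁ (i , ℕ.m<n⇒m<1+n i<j , f)
        grow K (inj₂ (l , _ , p)) = inj₁ (j , ℕ.≤-refl ,
          transport (borel-invariant (family-borel j)) (·-⁻¹· _ _)
            (piece-image j p))

        module _ {K : ℕ}
          (bounded : ∀ l {x} → K ≤ l → Orbit X z x → ¬ piece j l x) where

          below : ∀ {l x} → Orbit X z x → piece j l x → l < K
          below o p = [ (λ K≤l → ⊥-elim (bounded _ K≤l o p)) , id ]′
            (ℕ.≤-<-connex K _)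

          ungrow : ∀ {y} → Orbit X z y →
            config (suc j) 0 joined y → config j K joined y
          ungrow {y} o (inj₁ (i , i<1+j , f)) =
            [ (λ i<j → inj₁ (i , i<j , f)) ,
              (λ i≡j → let l , p = image-cover j
                             (≡.subst (λ i → family i y) i≡j f) in
                inj₂ (l , below (Orbit-· _ o) p , p)) ]′
              (ℕ.m<1+n⇒m<n∨m≡n i<1+j)

          exhausted : ∀ {x} → Orbit X z x → ¬ config j K rest x
          exhausted o (a , noPiece) =
            let l , p = piece-cover j a in noPiece (l , below o p , p)

      stuck-round : ∀ {j r} → (∀ k → ¬ Exchanges j k r) → StuckAt j 0 r →
        ∃[ s ] (r ≡ suc s × StuckAt (suc j) 0 s)
      stuck-round {j} {r} none stuck =
        let y , a , o     = complete z
            K , bounded   = piece-bound j z (y , a , o)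
            s , eq , next = stuck-shift z
              (σ-Relation.¬~ equality (config-invariant j K joined))
              (λ { zero → config-invariant j K rest ; (suc _) → invA })
              (exhausted bounded) (stuck-reach none stuck K)
        in s , eq , stuck-cong z
          (¬~ (agree (config-invariant (suc j) 0 joined)
            (λ _ → grow K) (ungrow bounded)))
          (λ { zero    → agree (config-invariant (suc j) 0 rest)
                           (λ _ a → a , λ ()) (λ _ → proj₁)
             ; (suc _) → invariant⇒onOrbit z invA })
          next

      mutual

        -- Induction on the bound: a round without a suitable exchange lowers it, and a leftover
        -- with bound 0 cannot survive such a round.
        exchange-exists : ∀ r j → StuckAt j 0 r →
          ∃[ i ] ∃[ k ] ∃[ s ] Exchanges i k s
        exchange-exists r j stuck =
          [ (λ { (k , ex) → j , k , r , ex }) ,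
            (λ none → next-round r j
              (stuck-round (λ k ex → none (k , ex)) stuck)) ]′
            (toSum (decide (∃[ k ] Exchanges j k r)))

        next-round : ∀ r j → ∃[ s ] (r ≡ suc s × StuckAt (suc j) 0 s) →
          ∃[ i ] ∃[ k ] ∃[ s ] Exchanges i k s
        next-round zero    j (_ , () , _)
        next-round (suc r) j (.r , ≡.refl , stuck) =
          exchange-exists r (suc j) stuck

      stuck-start : ∀ {r} → Stuck (∁ ∅) (λ _ → A) r z → StuckAt 0 0 r
      stuck-start = stuck-cong z
        (¬~ (agree (config-invariant 0 0 joined)
          (λ _ ()) (λ { _ (inj₁ ()) ; _ (inj₂ ()) })))
        (λ { zero    → agree (config-invariant 0 0 rest)
                         (λ _ a → a , λ ()) (λ _ → proj₁)
           ; (suc _) → invariant⇒onOrbit z invA })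

      exchange-works : ∀ {j k r} → Exchanges j k r →
        Compressed (shrink (config j k) (just (mover j k))) z
      exchange-works {j} {k} {r} (stuck , ¬stuck) =
        exchange-compressed (config-invariant j k) z (mover j k) r
          (moving⊆rest j k) (moves-out j k) stuck ¬stuck

    -- Index 0 is for orbits where all copies fit; the others run through the exchanges of piece `k`
    -- of copy `j`.
    labels : ℕ → Labels
    labels zero    = config 0 0
    labels (suc n) = uncurry config (unpair n)

    strategy : ℕ → Strategy
    strategy zero    = nothing
    strategy (suc n) = just (uncurry mover (unpair n))

    labels-borel : ∀ n i → BorelSet (labels n i)
    labels-borel zero    = config-borel 0 0
    labels-borel (suc n) = uncurry config-borel (unpair n)

    labels-invariant : ∀ n i → Invariant (labels n i)
    labels-invariant n i = borel-invariant (proj₁ (labels-borel n i))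

    compressed-somewhere : ∀ z →
      ∃[ n ] Compressed (shrink (labels n) (strategy n)) z
    compressed-somewhere z =
      [ (λ { (r , stuck) →
          let j , k , s , ex = exchange-exists z r 0 (stuck-start z stuck)
              n , eq         = unpair-surjective (j , k)
          in suc n , ≡.subst (λ p → Compressed
               (shrink (uncurry config p) (just (uncurry mover p))) z)
               (≡.sym eq) (exchange-works z ex) }) ,
        (λ never → let y , a , o = complete z in
          0 , copies-compressed (labels-invariant 0) z (y , o , a)
                (λ r stuck → never (r , stuck))) ]′
        (toSum (decide (∃[ r ] Stuck (∁ ∅) (λ _ → A) r z)))

    works : ℕ → Subset
    works n = Compressed (shrink (labels n) (strategy n))

    -- Different orbits need different labels; one quadruple serves all of them, each orbit
    -- receiving the labels of the first index that works there.
    glued : Labels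
    glued i = patch works (λ n → labels n i)

    glued-borel : ∀ i → BorelSet (glued i)
    glued-borel i = patch~ borelSets
      (λ n → Compressed~ borelSets
        (Strategy~.shrink~ borelSets (labels-borel n) (strategy n)))
      (λ n → labels-borel n i)

    -- The generator records labels but no index. The strategy is therefore found again from the
    -- labels, as the first one that compresses the orbit with them; it may differ from the one used
    -- for gluing.
    compression : Labels → ℕ → Subset
    compression I m = patch (λ n → Compressed (shrink I (strategy n)))
      (λ n → shrink I (strategy n) m)

    compression~ : ∀ (R : σ-Relation) {I I′ : Labels} →
      (∀ i → I i ~⟨ R ⟩ I′ i) → ∀ m → compression I m ~⟨ R ⟩ compression I′ m
    compression~ R r m = patch~ R (λ n → Compressed~ R (shrink~ (strategy n)))
      (λ n → shrink~ (strategy n) m)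
      where open Strategy~ R r

    shrink-invariant : ∀ {I : Labels} → (∀ i → Invariant (I i)) →
      ∀ s m → Invariant (shrink I s m)
    shrink-invariant = Strategy~.shrink~ equality

    reflect : ∀ {S S′ : ℕ → Subset} {z} →
      (∀ m → S m ~⟨ onOrbit z ⟩ S′ m) →
      Compressed S′ z → Compressed S z
    reflect {z = z} r =
      proj₂ (lower (Compressed~ (onOrbit z) r) (Orbit-refl z , refl))

    glued-works : ∀ z → ∃[ n ] Compressed (shrink glued (strategy n)) z
    glued-works z =
      let n , f = first-exists works (compressed-somewhere z) in
      n , reflect (Strategy~.shrink~ (onOrbit z) (agrees f) (strategy n)) (proj₁ f)
      where
      agrees : ∀ {n} → first works n z →
        ∀ i → glued i ~⟨ onOrbit z ⟩ labels n i
      agrees f i = patch-onOrbit works (λ n → labels n i)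
        (λ m → compressed-orbit
          (shrink-invariant (labels-invariant m) (strategy m)))
        (λ m → labels-invariant m i) f

    shrink-glued-invariant : ∀ n m → Invariant (shrink glued (strategy n) m)
    shrink-glued-invariant n = shrink-invariant
      (λ i → borel-invariant (proj₁ (glued-borel i))) (strategy n)

    compression-compressed : ∀ z → Compressed (compression glued) z
    compression-compressed z =
      let n , f = first-exists V (glued-works z) in
      reflect (λ m → patch-onOrbit V (λ n → shrink glued (strategy n) m)
        (λ k → compressed-orbit (shrink-glued-invariant k))
        (λ k → shrink-glued-invariant k m) f) (proj₁ f)
      where
      V : ℕ → Subset
      V n = Compressed (shrink glued (strategy n))

  -- Storing a basis

  missed : (ℕ → Subset) → Subset
  missed S = ∁ (Range S)

  -- The arrows of the `k`-th power of the injection, restricted to the points it misses; a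
  -- composite is again given by a single coded group element.
  iterate : (ℕ → Subset) → ℕ → ℕ → Subset
  iterate S zero    m x = m ≡ code ε × missed S x
  iterate S (suc k) m x = ∃[ a ] ∃[ b ]
    (m ≡ code (e b ∙ e a) × iterate S k a x × S b (e a · x))

  iterate~ : ∀ (R : σ-Relation) {S S′ : ℕ → Subset} →
    (∀ m → S m ~⟨ R ⟩ S′ m) → ∀ k m → iterate S k m ~⟨ R ⟩ iterate S′ k m
  iterate~ R s zero    m = (m ≡ code ε) ⟨×⟩~ ¬~ (Range~ R s)
    where open σ-Relation R
  iterate~ R s (suc k) m = ∃~ λ a → ∃~ λ b → (m ≡ code (e b ∙ e a)) ⟨×⟩~
    iterate~ R s k a ×~ shift~ (e a) (s b)
    where open σ-Relation R

  module Storage {S : ℕ → Subset} (inv : ∀ m → Invariant (S m))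
    (compressed : ∀ x → Compressed S x) where

    total : ∀ x → ∃[ m ] S m x
    total x with m , s ← proj₁ (compressed x) (code ε) =
      m , transport (inv m) (trans (code-· ε x) (·-id x)) s

    injective : ∀ {m n x y} → S m x → S n y → e m · x ≈ e n · y → m ≡ n
    injective {m} {n} {x} s s′ eq with decide₀ (m ≡ n)
    ... | yes m≡n = m≡n
    ... | no m≢n = ⊥-elim (proj₁ (proj₂ (compressed x)) (code ε) m n
      (m≢n , transport (inv m) x≈ s , transport (inv n)
        (·-move _ (trans (sym eq) (·-congˡ _ x≈))) s′))
      where
      x≈ : x ≈ e (code ε) · x
      x≈ = sym (trans (code-· ε x) (·-id x))

    iterate-source : ∀ k m {x} → iterate S k m x → missed S x
    iterate-source zero    m (_ , u)         = u
    iterate-source (suc k) m (a , _ , _ , c , _) = iterate-source k a c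

    iterate-total : ∀ k {x} → missed S x → ∃[ m ] iterate S k m x
    iterate-total zero    u = code ε , ≡.refl , u
    iterate-total (suc k) {x} u with a , c ← iterate-total k u
      with b , s ← total (e a · x) = _ , a , b , ≡.refl , c , s

    arrives : ∀ {m a b} x → m ≡ code (e b ∙ e a) → e m · x ≈ e b · e a · x
    arrives x ≡.refl = trans (code-· _ _) (·-assoc _ _ x)

    fixes : ∀ {m} x → m ≡ code ε → e m · x ≈ x
    fixes x ≡.refl = trans (code-· ε x) (·-id x)

    iterate-avoids : ∀ k {m n x y} → iterate S zero m x →
      iterate S (suc k) n y → ¬ (e m · x ≈ e n · y)
    iterate-avoids k {x = x} {y} (m≡ , u) (a , b , n≡ , _ , s) eq =
      u (b , range-intro {S} (inv b) s
        (trans (sym (arrives y n≡)) (trans (sym eq) (fixes x m≡))))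

    -- Cancel the last step on both sides. If one side runs out first, a missed point would lie in
    -- the range.
    iterate-injective : ∀ k l m n {x y} → iterate S k m x → iterate S l n y →
      e m · x ≈ e n · y → k ≡ l × m ≡ n
    iterate-injective zero zero m n (p , _) (q , _) _ =
      ≡.refl , ≡.trans p (≡.sym q)
    iterate-injective zero (suc l) m n p q eq =
      ⊥-elim (iterate-avoids l p q eq)
    iterate-injective (suc k) zero m n p q eq =
      ⊥-elim (iterate-avoids k q p (sym eq))
    iterate-injective (suc k) (suc l) m n {x} {y}
      (a , b , p , c , s) (a′ , b′ , p′ , c′ , s′) eq
      with eq′ ← trans (sym (arrives x p)) (trans eq (arrives y p′))
      with ≡.refl ← injective s s′ eq′
      with ≡.refl , ≡.refl ← iterate-injective k l a a′ c c′ (·-cancel (e b) eq′)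
      = ≡.refl , ≡.trans p (≡.sym p′)

    module _ (V : ℕ → Subset) (invV : ∀ k → Invariant (V k)) where

      store : Subset
      store y = ∃[ k ] ∃[ m ] (iterate S k m (m ⁻¹· y) × V k (m ⁻¹· y))

      -- The images of the missed set under different powers are disjoint, so following the `k`-th
      -- power and asking `store` meets only what layer `k` recorded.
      retrieve : ∀ k → (λ x → ∃[ m ] (iterate S k m x × store (e m · x))) ≐
                       (λ x → missed S x × V k x)
      retrieve k = forth , back
        where
        inv-iterate = iterate~ equality inv
        forth : ∀ {x} → ∃[ m ] (iterate S k m x × store (e m · x)) →
          missed S x × V k x
        forth {x} (m , c , l , n , c′ , v)
          with ≡.refl , ≡.refl ← iterate-injective k l m n c c′ (sym (·-⁻¹· _ _)) =
          iterate-source k m c , transport (invV k) (⁻¹·-· _ _) v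
        back : ∀ {x} → missed S x × V k x →
          ∃[ m ] (iterate S k m x × store (e m · x))
        back {x} (u , v) with m , c ← iterate-total k u =
          m , c , k , m , transport (inv-iterate k m) x≈ c ,
          transport (invV k) x≈ v
          where
          x≈ : x ≈ m ⁻¹· e m · x
          x≈ = sym (⁻¹·-· _ x)

    module _ (U : ℕ → Subset) (invU : ∀ n → Invariant (U n)) where

      -- `missed S` need not contain a given point `y`, but it contains some `e h · y`; there the
      -- translate of `U n` by `e h` answers whether `y` lies in `U n`.
      section : ℕ × ℕ → Subset
      section (h , n) = (e h ⁻¹ ·_) ⊢ U n

      section-invariant : ∀ p → Invariant (section p)
      section-invariant (h , n) =
        σ-Relation.shift~ equality (e h ⁻¹) (invU n)

      archive : Subset
      archive = store (section ∘ unpair) (section-invariant ∘ unpair)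

      restore~ : ∀ (R : σ-Relation) →
        (∀ m → S m ~⟨ R ⟩ S m) → archive ~⟨ R ⟩ archive → ∀ n → U n ~⟨ R ⟩ U n
      restore~ R s b n = resp~ eq eq (∃~ λ h → shift~ (e h)
        (∃~ λ m → iterate~ R s (index h) m ×~ shift~ (e m) b))
        where
        open σ-Relation R
        index : ℕ → ℕ
        index h = proj₁ (unpair-surjective (h , n))
        back : ∀ h → (λ x → missed S x × section (unpair (index h)) x) ≐
                     (λ x → missed S x × section (h , n) x)
        back h rewrite proj₂ (unpair-surjective (h , n)) = id , id
        read : ∀ h → (λ x → ∃[ m ] (iterate S (index h) m x ×
                       archive (e m · x))) ≐
                     (λ x → missed S x × section (h , n) x)
        read h =
          proj₁ (back h) ∘ proj₁ (retrieve _ (section-invariant ∘ unpair) _) ,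
          proj₂ (retrieve _ (section-invariant ∘ unpair) _) ∘ proj₂ (back h)
        eq : (λ y → ∃[ h ] ∃[ m ] (iterate S (index h) m (e h · y) ×
               archive (e m · e h · y))) ≐ U n
        eq = (λ { (h , r) → transport (invU n) (⁻¹·-· _ _)
                    (proj₂ (proj₁ (read h) r)) }) ,
             (λ {y} u → let h , out = proj₂ (proj₂ (compressed y)) in
                h , proj₂ (read h)
                  (out , transport (invU n) (sym (⁻¹·-· (e h) y)) u))

  -- Partitions generated by finitely many sets

  ∀Fin~ : ∀ (R : σ-Relation) {k} {A B : Fin k → Subset} →
    (∀ i → A i ~⟨ R ⟩ B i) → (λ x → ∀ i → A i x) ~⟨ R ⟩ (λ x → ∀ i → B i x)
  ∀Fin~ R {zero} r = resp~ all all (¬~ empty~)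
    where
    open σ-Relation R
    all : ∀ {A : Fin 0 → Subset} → ∁ ∅ ≐ (λ x → ∀ i → A i x)
    all = (λ _ ()) , (λ _ → lower)
  ∀Fin~ R {suc k} {A} {B} r =
    resp~ (split A) (split B) (r zero ×~ ∀Fin~ R (r ∘ suc))
    where
    open σ-Relation R
    split : ∀ (A : Fin (suc k) → Subset) →
      (λ x → A zero x × (∀ i → A (suc i) x)) ≐ (λ x → ∀ i → A i x)
    split A = (λ { (a , _) zero → a ; (_ , a) (suc i) → a i }) ,
              (λ a → a zero , a ∘ suc)

  holds : Fin 2 → Subset → Subset
  holds zero       A = ∁ A
  holds (suc zero) A = A

  holds~ : ∀ (R : σ-Relation) b {A B} →
    A ~⟨ R ⟩ B → holds b A ~⟨ R ⟩ holds b B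
  holds~ R zero       = σ-Relation.¬~ R
  holds~ R (suc zero) = id

  holds-unique : ∀ b c {A x} → holds b A x → holds c A x → b ≡ c
  holds-unique zero       zero       _  _ = ≡.refl
  holds-unique zero       (suc zero) ¬a a = ⊥-elim (¬a a)
  holds-unique (suc zero) zero       a ¬a = ⊥-elim (¬a a)
  holds-unique (suc zero) (suc zero) _  _ = ≡.refl

  holds-exists : ∀ A x → ∃[ b ] holds b A x
  holds-exists A x =
    [ (λ a → suc zero , a) , (λ ¬a → zero , ¬a) ]′ (toSum (decide (A x)))

  funToFin-cong : ∀ {m n} {f g : Fin m → Fin n} → (∀ i → f i ≡ g i) →
    funToFin f ≡ funToFin g
  funToFin-cong {zero}  eq = ≡.refl
  funToFin-cong {suc m} eq =
    ≡.cong₂ Fin.combine (eq zero) (funToFin-cong (eq ∘ suc))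

  module Atoms {k} (Y : Fin k → Subset) (borelY : ∀ i → BorelSet (Y i)) where

    bit : Fin (2 ℕ.^ k) → Fin k → Fin 2
    bit = finToFun

    atom : Fin (2 ℕ.^ k) → Subset
    atom n x = ∀ i → holds (bit n i) (Y i) x

    atom~ : ∀ n → BorelSet (atom n)
    atom~ n = ∀Fin~ borelSets λ i → holds~ borelSets (bit n i) (borelY i)

    atom-invariant : ∀ n → Invariant (atom n)
    atom-invariant n = borel-invariant (proj₁ (atom~ n))

    atom-cover : ∀ x → ∃[ n ] atom n x
    atom-cover x = funToFin value , λ i →
      ≡.subst (λ b → holds b (Y i) x)
        (≡.sym (Fin.finToFun-funToFin value i))
        (proj₂ (holds-exists (Y i) x))
      where
      value : Fin k → Fin 2
      value i = proj₁ (holds-exists (Y i) x)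

    atom-disjoint : ∀ m n {x} → atom m x → atom n x → m ≡ n
    atom-disjoint m n p q =
      ≡.trans (≡.sym (Fin.funToFin-finToFin {k} m))
        (≡.trans (funToFin-cong (λ i →
          holds-unique (bit m i) (bit n i) {Y i} (p i) (q i)))
          (Fin.funToFin-finToFin {k} n))

    -- Every point lies in an atom, whose `i`-th bit decides membership in `Y i`; excluding the
    -- atoms with bit zero leaves exactly `Y i`.
    atoms-recover : ∀ i → (λ x → ∀ n → ¬ (bit n i ≡ zero × atom n x)) ≐ Y i
    atoms-recover i =
      (λ {x} none → let n , p = atom-cover x in
        positive (bit n i) (p i) (λ b≡0 → none n (b≡0 , p))) ,
      (λ y n → λ { (b≡0 , p) → ≡.subst (λ b → holds b (Y i) _) b≡0 (p i) y })
      where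
      positive : ∀ b {x} → holds b (Y i) x → ¬ (b ≡ zero) → Y i x
      positive zero       _ b≢0 = ⊥-elim (b≢0 ≡.refl)
      positive (suc zero) y _   = y

    Translates : Pred Subset ℓ
    Translates C = ∃[ g ] ∃[ n ] C ≐ Translate X g (atom n)

    translate-≐ : ∀ g n → (g ⁻¹ ·_) ⊢ atom n ≐ Translate X g (atom n)
    translate-≐ g n =
      (λ p → _ , p , ·-⁻¹· g _) ,
      (λ { (x , p , eq) → transport (atom-invariant n) (·-move g eq) p })

    translates-shift : ∀ g {C} → C ∈ Translates →
      Generated Translates ((g ·_) ⊢ C)
    translates-shift g (h , n , C⊆ , ⊆C) = gen (g ⁻¹ ∙ h , n ,
      (λ c → let x , p , eq = C⊆ c in
        x , p , trans (·-assoc _ _ _) (sym (·-move g (sym eq)))) ,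
      (λ { (x , p , eq) → ⊆C (x , p , sym (trans (·-congˡ g (sym eq))
        (trans (·-congˡ g (·-assoc _ _ _)) (·-⁻¹· g _)))) }))

    generatedSets : σ-Relation
    generatedSets = generatedBy Translates translates-shift

    open σ-Relation generatedSets

    atoms~ : ∀ n → atom n ~ atom n
    atoms~ n = a , a
      where
      a : Generated Translates (atom n)
      a = gen (ε , n ,
        (λ p → _ , p , ·-id _) ,
        (λ { (x , p , eq) → transport (atom-invariant n)
          (trans (sym (·-id x)) eq) p }))

    Y~ : ∀ i → Y i ~ Y i
    Y~ i = resp~ (atoms-recover i) (atoms-recover i)
      (∀Fin~ generatedSets λ n → ¬~ ((bit n i ≡ zero) ⟨×⟩~ atoms~ n))

    generated⊆borel : ∀ {C} → Generated Translates C → BorelSet C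
    generated⊆borel (gen (g , n , C⊆ , ⊆C)) =
      B.resp~ eq eq (B.shift~ (g ⁻¹) (atom~ n))
      where
      module B = σ-Relation borelSets
      eq : (g ⁻¹ ·_) ⊢ atom n ≐ _
      eq = ⊆C ∘ proj₁ (translate-≐ g n) , proj₂ (translate-≐ g n) ∘ C⊆
    generated⊆borel empty     = σ-Relation.empty~ borelSets
    generated⊆borel (compl c) = σ-Relation.¬~ borelSets (generated⊆borel c)
    generated⊆borel (union c) =
      σ-Relation.∃~ borelSets (λ n → generated⊆borel (c n))
    generated⊆borel (resp (f , f′) c) =
      σ-Relation.resp~ borelSets (f , f′) (f , f′) (generated⊆borel c)

    generator : (∀ {V} → Metric.Open metric V → V ~ V) →
      Generator X (2 ℕ.^ k)
    generator opens = record
      { piece     = atom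
      ; borel     = λ n → proj₁ (atom~ n)
      ; disjoint  = λ m n m≢n (p , q) → m≢n (atom-disjoint m n p q)
      ; covers    = atom-cover
      ; generates = borel⊆generated ∘ proj₁ borel-≐ , proj₁ ∘ generated⊆borel
      }
      where
      borel⊆generated : ∀ {C} → Generated (Metric.Open metric) C →
        Generated Translates C
      borel⊆generated (gen o)    = proj₁ (opens o)
      borel⊆generated empty      = empty
      borel⊆generated (compl c)  = compl (borel⊆generated c)
      borel⊆generated (union c)  = union (borel⊆generated ∘ c)
      borel⊆generated (resp (f , f′) c) = resp (f , f′) (borel⊆generated c)

  -- A countable basis of balls

  open Metric metric using (d[_,_]<_; Open; triangle; rounded; symmetric)

  centre : ℕ → Maybe Carrier
  centre = proj₁ separable

  radius : ℕ → ℚ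
  radius = rational ∘ unpair

  ball : ℕ × ℕ → Subset
  ball (i , r) y = ∃[ c ] (centre i ≡ just c × d[ c , y ]< radius r)

  ball-open : ∀ p → Open (ball p)
  ball-open (i , r) y (c , eq , near) =
    let q , q<r , near′ = rounded near in
    -- By `rounded`, the distance from `c` to `y` is below some `q` smaller than the radius, and the
    -- difference is room enough around `y`.
    radius r ℚ.- q , difference-positive q (radius r) q<r , λ z close →
      c , eq , ≡.subst (d[ c , z ]<_) (difference q (radius r))
                 (triangle near′ close)

  ball-borel : ∀ p → BorelSet (ball p)
  ball-borel p = b , b
    where
    b : Borel (ball p)
    b = proj₂ borel-≐ (gen (ball-open p))

  -- Half of the room `q` around `x` goes to the distance from a dense point, the other half to the
  -- radius of the ball.
  ball-basis : ∀ {V x} → Open V → V x →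
    ∃[ n ] (ball (unpair n) x × ball (unpair n) ⊆ V)
  ball-basis {V} {x} isOpen v =
    let q , q>0 , inside    = isOpen x v
        p , rational≡       = rational-surjective (½ ℚ.* q) (halve-positive q q>0)
        r , unpair≡         = unpair-surjective p
        i , c , eq , near   = proj₂ separable x (½ ℚ.* q)
                                (halve-positive q q>0)
        n , unpair≡′        = unpair-surjective (i , r)
        radius≡             = ≡.trans (≡.cong rational unpair≡) rational≡
    in n , ≡.subst (λ p → ball p x × ball p ⊆ V) (≡.sym unpair≡′)
      ((c , eq , ≡.subst (d[ c , x ]<_) (≡.sym radius≡) (symmetric near)) ,
       λ { {y} (c′ , eq′ , near′) → inside y
         (≡.subst (d[ x , y ]<_) (halve q) (triangle
           (≡.subst (d[ x ,_]< (½ ℚ.* q))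
             (Maybe.just-injective (≡.trans (≡.sym eq) eq′)) near)
           (≡.subst (d[ c′ , y ]<_) radius≡ near′))) })

  open~ : ∀ (R : σ-Relation) →
    (∀ n → ball (unpair n) ~⟨ R ⟩ ball (unpair n)) → ∀ {V} → Open V → V ~⟨ R ⟩ V
  open~ R balls~ {V} isOpen = resp~ eq eq
    (∃~ λ n → const~ (ball (unpair n) ⊆ V) ×~ balls~ n)
    where
    open σ-Relation R
    eq : (λ x → ∃[ n ] (ball (unpair n) ⊆ V × ball (unpair n) x)) ≐ V
    eq = (λ { (n , inside , b) → inside b }) ,
         (λ v → let n , b , inside = ball-basis isOpen v in n , inside , b)

  -- The generator with 32 pieces

  module Encoding (I : Labels) (I-borel : ∀ i → BorelSet (I i))
    (decode : Labels → ℕ → Subset)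
    (decode~ : ∀ (R : σ-Relation) {I I′ : Labels} →
      (∀ i → I i ~⟨ R ⟩ I′ i) → ∀ m → decode I m ~⟨ R ⟩ decode I′ m)
    (compressed : ∀ x → Compressed (decode I) x) where

    decode-borel : ∀ m → BorelSet (decode I m)
    decode-borel = decode~ borelSets I-borel

    open Storage (λ m → borel-invariant (proj₁ (decode-borel m))) compressed

    balls : ℕ → Subset
    balls n = ball (unpair n)

    balls-invariant : ∀ n → Invariant (balls n)
    balls-invariant n = borel-invariant (proj₁ (ball-borel (unpair n)))

    archived : Subset
    archived = archive balls balls-invariant

    archived-borel : BorelSet archived
    archived-borel = ∃~ λ k → ∃~ λ m → shift~ (e m ⁻¹)
        (iterate~ borelSets decode-borel k m ×~ section-borel (unpair k))
      where
      open σ-Relation borelSets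
      section-borel : ∀ p → BorelSet (section balls balls-invariant p)
      section-borel (h , n) = shift~ (e h ⁻¹) (ball-borel (unpair n))

    bits : Fin 5 → Subset
    bits zero    = archived
    bits (suc i) = I i

    bits-borel : ∀ i → BorelSet (bits i)
    bits-borel zero    = archived-borel
    bits-borel (suc i) = I-borel i

    open Atoms bits bits-borel

    -- `decode~` and `restore~` hold for every `σ-Relation`, in particular for the σ-algebra
    -- generated by the translates of the pieces: it contains the labels, hence the sets describing
    -- the injection, hence with `archived` all basic balls, hence all open sets.
    thirtyTwo : Generator X 32
    thirtyTwo = generator (open~ generatedSets
      (restore~ balls balls-invariant generatedSets
        (decode~ generatedSets (Y~ ∘ suc)) (Y~ zero)))

corollary6p5 : ∀ {ℓ : Level} → ExcludedMiddle (lsuc ℓ) →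
    (G : Group ℓ ℓ) → CountablyInfinite (Group.setoid G) →
    (X : BorelGSpace G) →
    (Σ[ A ∈ Pred (BorelGSpace.Carrier X) ℓ ]
    (BorelGSpace.Borel X A × CompleteSection X A × LocallyFinitelyTraveling X A)) →
    Generator X 32
corollary6p5 em G enumeration X (A , borelA , complete , traveling) =
  Encoding.thirtyTwo glued glued-borel compression compression~
    compression-compressed
  where
  open Actions em G enumeration X
  open Traveling borelA complete traveling
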